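{- Fix an integer $s\geq 2$. For each $n$, let $G_n$ be a graph with $n$ vertices and $m_n$ edges, and let $\mathbf{c}_n(s)=(c_{1,n},\ldots,c_{s,n})$ be a composition of $n$ into $s$ positive parts ($\sum_i c_{i,n}=n$). Let $G_n$ be colored by a uniformly random $\mathbf{c}_n(s)$-coloring, and let $M_i(G_n)$, $M(G_n)$, $L(G_n)$ be as defined in the context. Let $\hat c_n=\min_{i\in[s]}c_{i,n}$ and $\zeta_n=\sqrt{\Sigma_2(G_n)}/m_n$. Assume $$\liminf_{n\to\infty}\frac{\hat c_n}{n}>0\quad\text{and}\quad m_n\to\infty .$$ Then: (i) If $\zeta_n=o(1)$, then for every $i\in[s]$, $$M_i(G_n)=(1+o_P(1))\,\mathbb{E}[M_i(G_n)],$$ where $o_P(1)$ denotes a random variable converging to $0$ in probability; in particular $L(G_n)/\mathbb{E}[L(G_n)]\to 1$ and $M(G_n)/\mathbb{E}[M(G_n)]\to 1$ in probability. (ii) Suppose $\zeta_n=\Theta(1)$ and let $\boldsymbol{\upsilon}_s=s^{ -1}\mathbf{1}_s$ (with $\mathbf{1}_s$ the all-ones vector in $\mathbb{R}^s$). If $\liminf_{n\to\infty}\|n^{ -1}\mathbf{c}_n(s)-\boldsymbol{\upsilon}_s\|>0$, then $$\liminf_{n\to\infty}\Pr\big(|M(G_n)-\mathbb{E}[M(G_n)]|>0\big)>0\quad\text{and}\quad\liminf_{n\to\infty}\Pr\big(|L(G_n)-\mathbb{E}[L(G_n)]|>0\big)>0 .$$ If instead $\|n^{ -1}\mathbf{c}_n(s)-\boldsymbol{\upsilon}_s\|\to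 0$, then $L(G_n)/\mathbb{E}[L(G_n)]\to 1$ and $M(G_n)/\mathbb{E}[M(G_n)]\to 1$ in probability.
   Context: A composition $\mathbf{c}=(c_1,\ldots,c_s)$ of $n$ into $s$ classes is a tuple of positive integers with $c_1+\cdots+c_s=n$. For a graph $G$ on $n$ vertices, a $\mathbf{c}$-coloring is a (surjective) map $f:V(G)\to[s]$ with $|f^{ -1}(\{i\})|=c_i$ for all $i$; the random $\mathbf{c}$-coloring model puts the uniform probability measure on the set of all $\mathbf{c}$-colorings (each has probability $c_1!\cdots c_s!/n!$). Under a random coloring, $M_i(G)$ is the number of edges both of whose endpoints have color $i$, $M(G)=\sum_{i=1}^s M_i(G)$ is the number of monochromatic edges, and $L(G)=m-M(G)$ is the number of edges whose endpoints receive different colors, where $m$ is the number of edges of $G$. $\Sigma_2(G)=\sum_{v\in V(G)}d_G(v)^2$ is the sum of squared degrees. $\zeta_n=\Theta(1)$ means $\zeta_n$ is bounded above and below by positive constants for all large $n$. -}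

module Defs where

open import Data.Bool using (Bool; true; false; _∧_)
open import Data.Nat as ℕ using (ℕ; zero; suc; _∸_; _≤_; _≡ᵇ_)
open import Data.Fin as Fin using (Fin)
open import Data.Fin.Properties as FinP using ()
open import Data.List as List using (List; []; _∷_; map; concatMap; filterᵇ; length; allFin; foldr)
open import Data.Product using (_×_; _,_; proj₁; proj₂; ∃)
open import Data.Nat.ListAction using (sum)
open import Data.Bool.ListAction using (and)
open import Data.Integer using (+_)
open import Data.Rational as ℚ using (ℚ; 0ℚ; _+_; _*_; _-_; ∣_∣; _<_; _≤_)
open import Data.Rational.Properties as ℚP using ()
open import Relation.Nullary.Decidable using (⌊_⌋)
open import Relation.Binary.PropositionalEquality using (_≡_)

record Graph (n : ℕ) : Set where
  field
    adj    : Fin n → Fin n → Bool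
    sym    : ∀ u v → adj u v ≡ adj v u
    irrefl : ∀ v → adj v v ≡ false
open Graph public

edges : ∀ {n} → Graph n → List (Fin n × Fin n)
edges {n} G =
  filterᵇ (λ p → ⌊ proj₁ p Fin.<? proj₂ p ⌋ ∧ adj G (proj₁ p) (proj₂ p))
          (List.cartesianProduct (allFin n) (allFin n))

numEdges : ∀ {n} → Graph n → ℕ
numEdges G = length (edges G)

degree : ∀ {n} → Graph n → Fin n → ℕ
degree {n} G v = length (filterᵇ (adj G v) (allFin n))

Σ₂ : ∀ {n} → Graph n → ℕ
Σ₂ {n} G = sum (map (λ v → degree G v ℕ.* degree G v) (allFin n))

IsComposition : (n s : ℕ) → (Fin s → ℕ) → Set
IsComposition n s c = ((i : Fin s) → 1 ℕ.≤ c i) × (sum (map c (allFin s)) ≡ n)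

allMaps : (n s : ℕ) → List (Fin n → Fin s)
allMaps zero    s = (λ ()) ∷ []
allMaps (suc n) s =
  concatMap (λ a → map (λ f → extend a f) (allMaps n s)) (allFin s)
  where
    extend : Fin s → (Fin n → Fin s) → Fin (suc n) → Fin s
    extend a f Fin.zero    = a
    extend a f (Fin.suc v) = f v

classSize : ∀ {n s} → (Fin n → Fin s) → Fin s → ℕ
classSize {n} f i = length (filterᵇ (λ v → ⌊ f v FinP.≟ i ⌋) (allFin n))

isCColoring : ∀ {n s} → (Fin s → ℕ) → (Fin n → Fin s) → Bool
isCColoring {n} {s} c f = and (map (λ i → classSize f i ≡ᵇ c i) (allFin s))

cColorings : (n s : ℕ) → (Fin s → ℕ) → List (Fin n → Fin s)
cColorings n s c = filterᵇ (isCColoring c) (allMaps n s)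

Mi : ∀ {n s} → Graph n → Fin s → (Fin n → Fin s) → ℕ
Mi G i f = length (filterᵇ (λ p → ⌊ f (proj₁ p) FinP.≟ i ⌋ ∧ ⌊ f (proj₂ p) FinP.≟ i ⌋) (edges G))

Mono : ∀ {n s} → Graph n → (Fin n → Fin s) → ℕ
Mono {s = s} G f = sum (map (λ i → Mi G i f) (allFin s))

Bi : ∀ {n s} → Graph n → (Fin n → Fin s) → ℕ
Bi G f = numEdges G ∸ Mono G f

ℕ→ℚ : ℕ → ℚ
ℕ→ℚ k = + k ℚ./ 1

-- a / b, with the (irrelevant) convention a / 0 = 0
ratio : ℕ → ℕ → ℚ
ratio a zero    = 0ℚ
ratio a (suc b) = + a ℚ./ suc b

𝔼 : (n s : ℕ) → (Fin s → ℕ) → ((Fin n → Fin s) → ℕ) → ℚ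
𝔼 n s c X = ratio (sum (map X (cColorings n s c))) (length (cColorings n s c))

Pr : (n s : ℕ) → (Fin s → ℕ) → ((Fin n → Fin s) → Bool) → ℚ
Pr n s c E = ratio (length (filterᵇ E (cColorings n s c))) (length (cColorings n s c))

-- the event  |X - E[X]| > ε · E[X]   (i.e. |X / E[X] - 1| > ε)
Deviates : (n s : ℕ) → (Fin s → ℕ) → ((Fin n → Fin s) → ℕ) → ℚ → (Fin n → Fin s) → Bool
Deviates n s c X ε f = ⌊ ε * 𝔼 n s c X ℚP.<? ∣ ℕ→ℚ (X f) - 𝔼 n s c X ∣ ⌋

Differs : (n s : ℕ) → (Fin s → ℕ) → ((Fin n → Fin s) → ℕ) → (Fin n → Fin s) → Bool
Differs n s c X f = ⌊ 0ℚ ℚP.<? ∣ ℕ→ℚ (X f) - 𝔼 n s c X ∣ ⌋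

-- X_n = (1 + o_P(1)) E[X_n]  (equivalently X_n / E[X_n] → 1 in probability):
-- for all ε, δ > 0, eventually Pr(|X_n - E X_n| > ε E X_n) < δ
RatioToOneInProb : (s : ℕ) → (ℕ → Fin s → ℕ) →
                   ((n : ℕ) → (Fin n → Fin s) → ℕ) → Set
RatioToOneInProb s c X =
  ∀ (ε δ : ℚ) → 0ℚ < ε → 0ℚ < δ →
    ∃ λ N → ∀ n → N ℕ.≤ n → Pr n s (c n) (Deviates n s (c n) (X n) ε) < δ

LiminfDiffersPos : (s : ℕ) → (ℕ → Fin s → ℕ) →
                   ((n : ℕ) → (Fin n → Fin s) → ℕ) → Set
LiminfDiffersPos s c X =
  ∃ λ κ → (0ℚ < κ) × ∃ λ N → ∀ n → N ℕ.≤ n → κ ℚ.≤ Pr n s (c n) (Differs n s (c n) (X n))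

distSq : (n s : ℕ) → (Fin s → ℕ) → ℚ
distSq n s c = foldr _+_ 0ℚ (map (λ i → (ratio (c i) n - ratio 1 s) * (ratio (c i) n - ratio 1 s)) (allFin s))

ζSq : ∀ {n} → Graph n → ℚ
ζSq G = ratio (Σ₂ G) (numEdges G ℕ.* numEdges G)

Eventually : (ℕ → Set) → Set
Eventually P = ∃ λ N → ∀ n → N ℕ.≤ n → P n

{-# OPTIONS --safe #-}
-- A random coloring is exchangeable and Σ_v [f v = i] = c_i is constant, so summing over v gives
-- E[[f u = i] Φ] = x_i E[Φ] + O(k/n), with x_i = c_i/n, for every Φ ∈ [0,1] depending on k vertices
-- other than u.  Hence the probability that k distinct vertices get prescribed colors is the product
-- of the x_i up to O(1/n).  For edges e, e′ with J common endpoints the indicators of "e has color i"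
-- and "e′ has color j" thus have covariance J V_ij + O(1/n), V_ij = [i=j] x_i³ − x_i² x_j², apart from
-- an O(1) error when e = e′.  Since J sums to Σ₂ over all pairs of edges,
--   Cov(M_i, M_j) = Σ₂ V_ij + O(m²/n + m).
-- All means are of order m, so Chebyshev's inequality gives concentration as soon as
-- Σ₂ Σ_ij V_ij = o(m²).  Finally Σ_ij V_ij = ½ Σ_ij x_i x_j (x_i − x_j)² is comparable to the squared
-- distance of x from the uniform vector; when that distance is bounded below and ζ_n = Θ(1), the
-- variance of M has order m², and Var M ≤ m² Pr(M ≠ E M) since |M − E M| ≤ m.
module Submission where

open import Defs hiding (sym)
open import Data.Bool using (Bool; true; false; _∧_; if_then_else_)
open import Data.Bool.ListAction using (and)
open import Data.Bool.Properties using (T-≡; T?; T-∧)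
open import Data.Nat as ℕ using (ℕ; zero; suc)
import Data.Nat.Properties as ℕP
import Data.Nat.Coprimality as ℕC
open import Data.Nat.ListAction using (sum)
open import Data.Integer as ℤ using ()
import Data.Integer.Properties as ℤP
open import Data.Rational hiding (NonZero; floor)
open import Data.Rational.Properties
import Data.Rational.Unnormalised as ℚᵘ
import Data.Rational.Unnormalised.Properties as ℚᵘP
open import Data.Fin as Fin using (Fin)
import Data.Fin.Properties as FinP
open import Data.Fin.Permutation as Perm using (Permutation′; _⟨$⟩ʳ_)
open import Data.Vec.Functional as VF using (insertAt)
import Data.Vec.Functional.Properties as VFP
import Algebra.Properties.CommutativeMonoid.Sum +-0-commutativeMonoid as Sum
open import Data.List
  using (List; []; _∷_; map; concatMap; filterᵇ; length; allFin; foldr; _++_; cartesianProduct)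
import Data.List.Properties as ListP
open import Data.List.Membership.Propositional using (_∈_)
open import Data.List.Membership.Propositional.Properties using (∈-filter⁻)
open import Data.List.Relation.Unary.All using (All; []; _∷_)
import Data.List.Relation.Unary.All.Properties as AllP
open import Data.List.Relation.Unary.AllPairs using (AllPairs; []; _∷_)
open import Data.List.Relation.Unary.Any as Any using (Any; here; there)
open import Data.Product using (_×_; _,_; proj₁; proj₂; ∃)
open import Data.Sum using (inj₁; inj₂)
open import Data.Unit using (tt)
open import Function using (_∘_; Equivalence)
open import Relation.Binary using (tri<; tri≈; tri>)
open import Relation.Binary.PropositionalEquality hiding ([_])
open import Relation.Nullary using (¬_; Dec; yes; no)
open import Relation.Nullary.Decidable using (⌊_⌋; toWitness; dec-true; dec-false; dec⇒maybe)
open import Relation.Nullary.Negation using (contradiction)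
open import Tactic.RingSolver using (solve-∀)
open import Tactic.RingSolver.Core.AlmostCommutativeRing using (AlmostCommutativeRing; fromCommutativeRing)

-- Colorings are never counted: neither multinomial coefficients nor falling factorials occur. The
-- facts used about the list of colorings are its invariance under vertex permutations, its constant
-- class sizes and that it is nonempty. The price is that joint probabilities come as inequalities
-- with an explicit number of units 1/n: k distinct vertices cost k(k-1)/2 of them, which is the
-- origin of the numerical constants. Permutation invariance is the delicate point, because maps are
-- enumerated by the color of vertex 0, then of vertex 1, and so on, and are determined only up to
-- pointwise equality. The means are of order m for different reasons. For M_i the density is near
-- x_i², while for L it is near 1 - Σ x_k² ≥ x_i x_j with i ≠ j, which is where two colors are
-- required. Asymptotic bounds are multiplied out, in the form "at most ν m²", so that m is divided
-- out only once it is known to be positive.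

ℚ-ring : AlmostCommutativeRing _ _
ℚ-ring = fromCommutativeRing +-*-commutativeRing λ x → dec⇒maybe (0ℚ ≟ x)

-- Ordered-field arithmetic in ℚ

0≤1 : 0ℚ ≤ 1ℚ
0≤1 = *≤* (ℤ.+≤+ ℕ.z≤n)

0<1 : 0ℚ < 1ℚ
0<1 = *<* (ℤ.+<+ (ℕ.s≤s ℕ.z≤n))

p≤q⇒0≤q-p : ∀ {p q} → p ≤ q → 0ℚ ≤ q - p
p≤q⇒0≤q-p {p} {q} h = subst (_≤ q - p) (+-inverseʳ p) (+-monoˡ-≤ (- p) h)

0≤q-p⇒p≤q : ∀ {p q} → 0ℚ ≤ q - p → p ≤ q
0≤q-p⇒p≤q {p} {q} h = subst₂ _≤_ (+-identityˡ p) (lem q p) (+-monoˡ-≤ p h)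
  where lem : ∀ q p → q - p + p ≡ q
        lem = solve-∀ ℚ-ring

≤-from-diff : ∀ {p q r} → 0ℚ ≤ r → q - p ≡ r → p ≤ q
≤-from-diff h e = 0≤q-p⇒p≤q (subst (0ℚ ≤_) (sym e) h)

0≤+ : ∀ {p q} → 0ℚ ≤ p → 0ℚ ≤ q → 0ℚ ≤ p + q
0≤+ = +-mono-≤

0≤* : ∀ {p q} → 0ℚ ≤ p → 0ℚ ≤ q → 0ℚ ≤ p * q
0≤* {p} {q} hp hq = nonNegative⁻¹ _ {{nonNeg*nonNeg⇒nonNeg p {{nonNegative hp}} q {{nonNegative hq}}}}

0<* : ∀ {p q} → 0ℚ < p → 0ℚ < q → 0ℚ < p * q
0<* {p} {q} hp hq = positive⁻¹ _ {{pos*pos⇒pos p {{positive hp}} q {{positive hq}}}}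

*-monoˡ : ∀ {r p q} → 0ℚ ≤ r → p ≤ q → r * p ≤ r * q
*-monoˡ {r} h = *-monoˡ-≤-nonNeg r {{nonNegative h}}

*-monoʳ : ∀ {r p q} → 0ℚ ≤ r → p ≤ q → p * r ≤ q * r
*-monoʳ {r} h = *-monoʳ-≤-nonNeg r {{nonNegative h}}

*-mono : ∀ {p q p′ q′} → 0ℚ ≤ p → 0ℚ ≤ q′ → p ≤ p′ → q ≤ q′ → p * q ≤ p′ * q′
*-mono hp hq h h′ = ≤-trans (*-monoˡ hp h′) (*-monoʳ hq h)

0≤p² : ∀ p → 0ℚ ≤ p * p
0≤p² p with ≤-total 0ℚ p
... | inj₁ h = 0≤* h h
... | inj₂ h = subst (0ℚ ≤_) (lem p) (0≤* (neg-antimono-≤ h) (neg-antimono-≤ h))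
  where lem : ∀ p → (- p) * (- p) ≡ p * p
        lem = solve-∀ ℚ-ring

p≤∣p∣ : ∀ p → p ≤ ∣ p ∣
p≤∣p∣ p with ≤-total 0ℚ p
... | inj₁ h = ≤-reflexive (sym (0≤p⇒∣p∣≡p h))
... | inj₂ h = ≤-trans h (0≤∣p∣ p)

-p≤∣p∣ : ∀ p → - p ≤ ∣ p ∣
-p≤∣p∣ p = subst (- p ≤_) (∣-p∣≡∣p∣ p) (p≤∣p∣ (- p))

∣p∣≤ : ∀ {p q} → p ≤ q → - p ≤ q → ∣ p ∣ ≤ q
∣p∣≤ {p} h h′ with ∣p∣≡p∨∣p∣≡-p p
... | inj₁ e = subst (_≤ _) (sym e) h
... | inj₂ e = subst (_≤ _) (sym e) h′

∣∣-triangle : ∀ p q r → ∣ p - r ∣ ≤ ∣ p - q ∣ + ∣ q - r ∣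
∣∣-triangle p q r = subst (λ t → ∣ t ∣ ≤ ∣ p - q ∣ + ∣ q - r ∣) (lem p q r) (∣p+q∣≤∣p∣+∣q∣ (p - q) (q - r))
  where lem : ∀ p q r → p - q + (q - r) ≡ p - r
        lem = solve-∀ ℚ-ring

∣p∣²≡p² : ∀ p → ∣ p ∣ * ∣ p ∣ ≡ p * p
∣p∣²≡p² p = trans (sym (∣p*q∣≡∣p∣*∣q∣ p p)) (0≤p⇒∣p∣≡p (0≤p² p))

∣x-y∣≤ : ∀ {x y r} → 0ℚ ≤ x → x ≤ r → 0ℚ ≤ y → y ≤ r → ∣ x - y ∣ ≤ r
∣x-y∣≤ {x} {y} {r} hx hx′ hy hy′ = ∣p∣≤
  (≤-from-diff (0≤+ (p≤q⇒0≤q-p hx′) hy) (l1 x y r))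
  (≤-from-diff (0≤+ (p≤q⇒0≤q-p hy′) hx) (l2 x y r))
  where
  l1 : ∀ x y r → r - (x - y) ≡ (r - x) + y
  l1 = solve-∀ ℚ-ring
  l2 : ∀ x y r → r - - (x - y) ≡ (r - y) + x
  l2 = solve-∀ ℚ-ring

-- `ℕ→ℚ` normalises its fraction through a gcd, which does not compute on a variable. With this
-- canonical form, sums, products and comparisons reduce to integer arithmetic.
ℕ→ℚ-mkℚ : ∀ k → ℕ→ℚ k ≡ mkℚ (ℤ.+ k) 0 (ℕC.sym (ℕC.1-coprimeTo k))
ℕ→ℚ-mkℚ k = normalize-coprime _

toℚᵘ-ℕ→ℚ : ∀ k → toℚᵘ (ℕ→ℚ k) ≡ ℚᵘ.mkℚᵘ (ℤ.+ k) 0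
toℚᵘ-ℕ→ℚ k = cong toℚᵘ (ℕ→ℚ-mkℚ k)

ℕ→ℚ-+ : ∀ a b → ℕ→ℚ (a ℕ.+ b) ≡ ℕ→ℚ a + ℕ→ℚ b
ℕ→ℚ-+ a b = toℚᵘ-injective (ℚᵘP.≃-trans (ℚᵘP.≃-reflexive (toℚᵘ-ℕ→ℚ (a ℕ.+ b)))
  (ℚᵘP.≃-sym (ℚᵘP.≃-trans (toℚᵘ-homo-+ (ℕ→ℚ a) (ℕ→ℚ b))
  (ℚᵘP.≃-trans (ℚᵘP.≃-reflexive (cong₂ ℚᵘ._+_ (toℚᵘ-ℕ→ℚ a) (toℚᵘ-ℕ→ℚ b)))
  (ℚᵘ.*≡* (cong (ℤ._* (ℤ.+ 1)) (cong₂ ℤ._+_ (ℤP.*-identityʳ (ℤ.+ a)) (ℤP.*-identityʳ (ℤ.+ b)))))))))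

ℕ→ℚ-* : ∀ a b → ℕ→ℚ (a ℕ.* b) ≡ ℕ→ℚ a * ℕ→ℚ b
ℕ→ℚ-* a b = toℚᵘ-injective (ℚᵘP.≃-trans (ℚᵘP.≃-reflexive (toℚᵘ-ℕ→ℚ (a ℕ.* b)))
  (ℚᵘP.≃-sym (ℚᵘP.≃-trans (toℚᵘ-homo-* (ℕ→ℚ a) (ℕ→ℚ b))
  (ℚᵘP.≃-trans (ℚᵘP.≃-reflexive (cong₂ ℚᵘ._*_ (toℚᵘ-ℕ→ℚ a) (toℚᵘ-ℕ→ℚ b)))
  (ℚᵘ.*≡* (cong (ℤ._* (ℤ.+ 1)) (sym (ℤP.pos-* a b))))))))

ℕ→ℚ-mono : ∀ {a b} → a ℕ.≤ b → ℕ→ℚ a ≤ ℕ→ℚ b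
ℕ→ℚ-mono {a} {b} h = subst₂ _≤_ (sym (ℕ→ℚ-mkℚ a)) (sym (ℕ→ℚ-mkℚ b))
  (*≤* (subst₂ ℤ._≤_ (sym (ℤP.*-identityʳ (ℤ.+ a))) (sym (ℤP.*-identityʳ (ℤ.+ b))) (ℤ.+≤+ h)))

ℕ→ℚ-cancel-≤ : ∀ {a b} → ℕ→ℚ a ≤ ℕ→ℚ b → a ℕ.≤ b
ℕ→ℚ-cancel-≤ {a} {b} h = ℤP.drop‿+≤+ (subst₂ ℤ._≤_ (ℤP.*-identityʳ (ℤ.+ a)) (ℤP.*-identityʳ (ℤ.+ b))
  (drop-*≤* (subst₂ _≤_ (ℕ→ℚ-mkℚ a) (ℕ→ℚ-mkℚ b) h)))

ℕ→ℚ-injective : ∀ {a b} → ℕ→ℚ a ≡ ℕ→ℚ b → a ≡ b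
ℕ→ℚ-injective e = ℕP.≤-antisym (ℕ→ℚ-cancel-≤ (≤-reflexive e)) (ℕ→ℚ-cancel-≤ (≤-reflexive (sym e)))

0≤ℕ : ∀ a → 0ℚ ≤ ℕ→ℚ a
0≤ℕ a = ℕ→ℚ-mono {0} {a} ℕ.z≤n

0<ℕ : ∀ {a} → 1 ℕ.≤ a → 0ℚ < ℕ→ℚ a
0<ℕ h = <-≤-trans 0<1 (ℕ→ℚ-mono h)

ratio-* : ∀ a b → 1 ℕ.≤ b → ratio a b * ℕ→ℚ b ≡ ℕ→ℚ a
ratio-* a (suc b) _ = toℚᵘ-injective (ℚᵘP.≃-trans (toℚᵘ-homo-* (ratio a (suc b)) (ℕ→ℚ (suc b)))
  (ℚᵘP.≃-trans (ℚᵘP.*-cong (toℚᵘ-fromℚᵘ (ℚᵘ.mkℚᵘ (ℤ.+ a) b)) (ℚᵘP.≃-reflexive (toℚᵘ-ℕ→ℚ (suc b))))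
  (ℚᵘP.≃-trans (ℚᵘ.*≡* (trans (ℤP.*-identityʳ _) (cong (λ t → ℤ.+ a ℤ.* ℤ.+ suc t) (sym (ℕP.*-identityʳ b)))))
   (ℚᵘP.≃-reflexive (sym (toℚᵘ-ℕ→ℚ a))))))

-- With the denominator pulled out as a fixed factor, averages and probabilities over the same list
-- become linear in their numerators.
ratio≡ : ∀ a b → 1 ℕ.≤ b → ratio a b ≡ ratio 1 b * ℕ→ℚ a
ratio≡ a b h = begin
  ratio a b                              ≡⟨ *-identityʳ _ ⟨
  ratio a b * 1ℚ                         ≡⟨ cong (ratio a b *_) (ratio-* 1 b h) ⟨
  ratio a b * (ratio 1 b * ℕ→ℚ b)        ≡⟨ lem (ratio a b) (ratio 1 b) (ℕ→ℚ b) ⟩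
  ratio 1 b * (ratio a b * ℕ→ℚ b)        ≡⟨ cong (ratio 1 b *_) (ratio-* a b h) ⟩
  ratio 1 b * ℕ→ℚ a                      ∎
  where open ≡-Reasoning
        lem : ∀ x y z → x * (y * z) ≡ y * (x * z)
        lem = solve-∀ ℚ-ring

0≤ratio : ∀ a b → 0ℚ ≤ ratio a b
0≤ratio a zero = ≤-refl
0≤ratio a (suc b) = nonNegative⁻¹ _ {{normalize-nonNeg a (suc b)}}

-- Finite sums and indicators

∑ : ∀ {A : Set} → List A → (A → ℚ) → ℚ
∑ [] f = 0ℚ
∑ (x ∷ xs) f = f x + ∑ xs f

module _ {A : Set} where
  ∑-cong : ∀ (xs : List A) {f g} → (∀ x → f x ≡ g x) → ∑ xs f ≡ ∑ xs g
  ∑-cong [] h = refl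
  ∑-cong (x ∷ xs) h = cong₂ _+_ (h x) (∑-cong xs h)

  ∑-mono : ∀ (xs : List A) {f g} → (∀ x → f x ≤ g x) → ∑ xs f ≤ ∑ xs g
  ∑-mono [] h = ≤-refl
  ∑-mono (x ∷ xs) h = +-mono-≤ (h x) (∑-mono xs h)

  ∑-+ : ∀ (xs : List A) f g → ∑ xs (λ x → f x + g x) ≡ ∑ xs f + ∑ xs g
  ∑-+ [] f g = refl
  ∑-+ (x ∷ xs) f g = trans (cong (λ t → f x + g x + t) (∑-+ xs f g)) (lem (f x) (g x) (∑ xs f) (∑ xs g))
    where lem : ∀ a b c d → (a + b) + (c + d) ≡ (a + c) + (b + d)
          lem = solve-∀ ℚ-ring

  ∑-*ˡ : ∀ k (xs : List A) f → ∑ xs (λ x → k * f x) ≡ k * ∑ xs f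
  ∑-*ˡ k [] f = sym (*-zeroʳ k)
  ∑-*ˡ k (x ∷ xs) f = trans (cong (λ t → k * f x + t) (∑-*ˡ k xs f)) (sym (*-distribˡ-+ k (f x) (∑ xs f)))

  ∑-*ʳ : ∀ k (xs : List A) f → ∑ xs (λ x → f x * k) ≡ ∑ xs f * k
  ∑-*ʳ k xs f = trans (∑-cong xs (λ x → *-comm (f x) k)) (trans (∑-*ˡ k xs f) (*-comm k _))

  ∑-neg : ∀ (xs : List A) f → ∑ xs (λ x → - f x) ≡ - ∑ xs f
  ∑-neg [] f = refl
  ∑-neg (x ∷ xs) f = trans (cong (λ t → - f x + t) (∑-neg xs f)) (sym (neg-distrib-+ (f x) (∑ xs f)))

  ∑-- : ∀ (xs : List A) f g → ∑ xs (λ x → f x - g x) ≡ ∑ xs f - ∑ xs g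
  ∑-- xs f g = trans (∑-+ xs f (λ x → - g x)) (cong (∑ xs f +_) (∑-neg xs g))

  ∑-const : ∀ (xs : List A) k → ∑ xs (λ _ → k) ≡ ℕ→ℚ (length xs) * k
  ∑-const [] k = sym (*-zeroˡ k)
  ∑-const (x ∷ xs) k = begin
    k + ∑ xs (λ _ → k)             ≡⟨ cong₂ _+_ (sym (*-identityˡ k)) (∑-const xs k) ⟩
    1ℚ * k + ℕ→ℚ (length xs) * k   ≡⟨ *-distribʳ-+ k 1ℚ (ℕ→ℚ (length xs)) ⟨
    (1ℚ + ℕ→ℚ (length xs)) * k     ≡⟨ cong (_* k) (ℕ→ℚ-+ 1 (length xs)) ⟨
    ℕ→ℚ (suc (length xs)) * k      ∎
    where open ≡-Reasoning

  ∑-0 : ∀ (xs : List A) → ∑ xs (λ _ → 0ℚ) ≡ 0ℚ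
  ∑-0 xs = trans (∑-const xs 0ℚ) (*-zeroʳ (ℕ→ℚ (length xs)))

  0≤∑ : ∀ (xs : List A) {f} → (∀ x → 0ℚ ≤ f x) → 0ℚ ≤ ∑ xs f
  0≤∑ xs {f} h = subst (_≤ ∑ xs f) (∑-0 xs) (∑-mono xs h)

  ∣∑∣≤ : ∀ (xs : List A) f → ∣ ∑ xs f ∣ ≤ ∑ xs (λ x → ∣ f x ∣)
  ∣∑∣≤ [] f = ≤-refl
  ∣∑∣≤ (x ∷ xs) f = ≤-trans (∣p+q∣≤∣p∣+∣q∣ (f x) (∑ xs f)) (+-monoʳ-≤ ∣ f x ∣ (∣∑∣≤ xs f))

  ∑-++ : ∀ (xs ys : List A) f → ∑ (xs ++ ys) f ≡ ∑ xs f + ∑ ys f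
  ∑-++ [] ys f = sym (+-identityˡ _)
  ∑-++ (x ∷ xs) ys f = trans (cong (f x +_) (∑-++ xs ys f)) (sym (+-assoc (f x) _ _))

∑-swap : ∀ {A B : Set} (xs : List A) (ys : List B) (f : A → B → ℚ) →
         ∑ xs (λ x → ∑ ys (f x)) ≡ ∑ ys (λ y → ∑ xs (λ x → f x y))
∑-swap [] ys f = sym (∑-0 ys)
∑-swap (x ∷ xs) ys f = trans (cong (∑ ys (f x) +_) (∑-swap xs ys f)) (sym (∑-+ ys (f x) (λ y → ∑ xs (λ x → f x y))))

𝟙 : Bool → ℚ
𝟙 true = 1ℚ
𝟙 false = 0ℚ

0≤𝟙 : ∀ b → 0ℚ ≤ 𝟙 b
0≤𝟙 true = 0≤1
0≤𝟙 false = ≤-refl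

𝟙≤1 : ∀ b → 𝟙 b ≤ 1ℚ
𝟙≤1 true = ≤-refl
𝟙≤1 false = 0≤1

𝟙-∧ : ∀ a b → 𝟙 (a ∧ b) ≡ 𝟙 a * 𝟙 b
𝟙-∧ true true = refl
𝟙-∧ true false = refl
𝟙-∧ false true = refl
𝟙-∧ false false = refl

module _ {A : Set} where
  ∑-filterᵇ : ∀ (p : A → Bool) xs f → ∑ (filterᵇ p xs) f ≡ ∑ xs (λ x → 𝟙 (p x) * f x)
  ∑-filterᵇ p [] f = refl
  ∑-filterᵇ p (x ∷ xs) f with p x
  ... | true  = cong₂ _+_ (sym (*-identityˡ (f x))) (∑-filterᵇ p xs f)
  ... | false = trans (∑-filterᵇ p xs f) (sym (trans (cong (_+ _) (*-zeroˡ (f x))) (+-identityˡ _)))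

  length-filterᵇ : ∀ (p : A → Bool) xs → ℕ→ℚ (length (filterᵇ p xs)) ≡ ∑ xs (λ x → 𝟙 (p x))
  length-filterᵇ p [] = refl
  length-filterᵇ p (x ∷ xs) with p x
  ... | true  = trans (ℕ→ℚ-+ 1 (length (filterᵇ p xs))) (cong (1ℚ +_) (length-filterᵇ p xs))
  ... | false = trans (length-filterᵇ p xs) (sym (+-identityˡ _))

  ℕ→ℚ-sum : ∀ (f : A → ℕ) xs → ℕ→ℚ (sum (map f xs)) ≡ ∑ xs (ℕ→ℚ ∘ f)
  ℕ→ℚ-sum f [] = refl
  ℕ→ℚ-sum f (x ∷ xs) = trans (ℕ→ℚ-+ (f x) (sum (map f xs))) (cong (ℕ→ℚ (f x) +_) (ℕ→ℚ-sum f xs))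

  foldr-∑ : ∀ (f : A → ℚ) xs → foldr _+_ 0ℚ (map f xs) ≡ ∑ xs f
  foldr-∑ f [] = refl
  foldr-∑ f (x ∷ xs) = cong (f x +_) (foldr-∑ f xs)

  ∑-map : ∀ {B : Set} (g : A → B) xs f → ∑ (map g xs) f ≡ ∑ xs (f ∘ g)
  ∑-map g [] f = refl
  ∑-map g (x ∷ xs) f = cong (f (g x) +_) (∑-map g xs f)

∑-concatMap : ∀ {A B : Set} (g : A → List B) xs f → ∑ (concatMap g xs) f ≡ ∑ xs (λ x → ∑ (g x) f)
∑-concatMap g [] f = refl
∑-concatMap g (x ∷ xs) f = trans (∑-++ (g x) (concatMap g xs) f) (cong (∑ (g x) f +_) (∑-concatMap g xs f))

∑-cartesianProduct : ∀ {A B : Set} (xs : List A) (ys : List B) f →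
  ∑ (cartesianProduct xs ys) f ≡ ∑ xs (λ x → ∑ ys (λ y → f (x , y)))
∑-cartesianProduct [] ys f = refl
∑-cartesianProduct (x ∷ xs) ys f = trans (∑-++ (map (x ,_) ys) _ f)
  (cong₂ _+_ (∑-map (x ,_) ys f) (∑-cartesianProduct xs ys f))

∑-allFin-suc : ∀ {n} (f : Fin (suc n) → ℚ) → ∑ (allFin (suc n)) f ≡ f Fin.zero + ∑ (allFin n) (f ∘ Fin.suc)
∑-allFin-suc {n} f = cong (f Fin.zero +_) (trans (cong (λ l → ∑ l f) (sym (ListP.map-tabulate (λ i → i) Fin.suc))) (∑-map Fin.suc (allFin n) f))

δ : ∀ {n} → Fin n → Fin n → ℚ
δ i j = 𝟙 ⌊ i FinP.≟ j ⌋

δ-refl : ∀ {n} (i : Fin n) → δ i i ≡ 1ℚ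
δ-refl i with i FinP.≟ i
... | yes _ = refl
... | no i≢i = contradiction refl i≢i

δ-≡ : ∀ {n} {i j : Fin n} → i ≡ j → δ i j ≡ 1ℚ
δ-≡ {i = i} refl = δ-refl i

δ-≢ : ∀ {n} {i j : Fin n} → i ≢ j → δ i j ≡ 0ℚ
δ-≢ {i = i} {j} i≢j with i FinP.≟ j
... | yes i≡j = contradiction i≡j i≢j
... | no _ = refl

δ-sym : ∀ {n} (i j : Fin n) → δ i j ≡ δ j i
δ-sym i j with i FinP.≟ j
... | yes i≡j = sym (δ-≡ (sym i≡j))
... | no i≢j = sym (δ-≢ (i≢j ∘ sym))

δ-suc : ∀ {n} (i j : Fin n) → δ (Fin.suc i) (Fin.suc j) ≡ δ i j
δ-suc i j with i FinP.≟ j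
... | yes i≡j = refl
... | no i≢j = refl

∑-δ : ∀ {n} (i : Fin n) (f : Fin n → ℚ) → ∑ (allFin n) (λ j → δ i j * f j) ≡ f i
∑-δ {suc n} Fin.zero f = begin
  ∑ (allFin (suc n)) (λ j → δ Fin.zero j * f j)                  ≡⟨ ∑-allFin-suc (λ j → δ Fin.zero j * f j) ⟩
  1ℚ * f Fin.zero + ∑ (allFin n) (λ j → 0ℚ * f (Fin.suc j))      ≡⟨ cong₂ _+_ (*-identityˡ (f Fin.zero)) (∑-*ˡ 0ℚ (allFin n) (f ∘ Fin.suc)) ⟩
  f Fin.zero + 0ℚ * ∑ (allFin n) (f ∘ Fin.suc)                   ≡⟨ lem (f Fin.zero) (∑ (allFin n) (f ∘ Fin.suc)) ⟩
  f Fin.zero                                                     ∎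
  where open ≡-Reasoning
        lem : ∀ x y → x + 0ℚ * y ≡ x
        lem = solve-∀ ℚ-ring
∑-δ {suc n} (Fin.suc i) f = begin
  ∑ (allFin (suc n)) (λ j → δ (Fin.suc i) j * f j)                               ≡⟨ ∑-allFin-suc (λ j → δ (Fin.suc i) j * f j) ⟩
  0ℚ * f Fin.zero + ∑ (allFin n) (λ j → δ (Fin.suc i) (Fin.suc j) * f (Fin.suc j)) ≡⟨ cong₂ _+_ (*-zeroˡ (f Fin.zero)) (∑-cong (allFin n) (λ j → cong (_* f (Fin.suc j)) (δ-suc i j))) ⟩
  0ℚ + ∑ (allFin n) (λ j → δ i j * f (Fin.suc j))                                 ≡⟨ +-identityˡ _ ⟩
  ∑ (allFin n) (λ j → δ i j * f (Fin.suc j))                                      ≡⟨ ∑-δ i (f ∘ Fin.suc) ⟩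
  f (Fin.suc i)                                                                   ∎
  where open ≡-Reasoning

∑-δ1 : ∀ {n} (i : Fin n) → ∑ (allFin n) (δ i) ≡ 1ℚ
∑-δ1 {n} i = trans (∑-cong (allFin n) (λ j → sym (*-identityʳ (δ i j)))) (∑-δ i (λ _ → 1ℚ))

term≤∑ : ∀ {n} (i : Fin n) (f : Fin n → ℚ) → (∀ j → 0ℚ ≤ f j) → f i ≤ ∑ (allFin n) f
term≤∑ {n} i f h = subst (_≤ ∑ (allFin n) f) (∑-δ i f)
  (∑-mono (allFin n) (λ j → subst (δ i j * f j ≤_) (*-identityˡ (f j)) (*-monoʳ (h j) (𝟙≤1 ⌊ i FinP.≟ j ⌋))))

∑-allFin≡sum : ∀ {n} (f : Fin n → ℚ) → ∑ (allFin n) f ≡ Sum.sum f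
∑-allFin≡sum {zero} f = refl
∑-allFin≡sum {suc n} f = trans (∑-allFin-suc f) (cong (f Fin.zero +_) (∑-allFin≡sum (f ∘ Fin.suc)))

∑-permute : ∀ {n} (π : Permutation′ n) (f : Fin n → ℚ) → ∑ (allFin n) (λ v → f (π ⟨$⟩ʳ v)) ≡ ∑ (allFin n) f
∑-permute π f = trans (∑-allFin≡sum (λ v → f (π ⟨$⟩ʳ v))) (trans (sym (Sum.sum-permute f π)) (sym (∑-allFin≡sum f)))

-- Exchangeability of the coloring model

-- Pointwise equal maps need not be propositionally equal, and `allMaps` represents each of them
-- only up to pointwise equality. Sums over it are rearranged for functionals that do not see the
-- difference.
Resp : ∀ {n s} → ((Fin n → Fin s) → ℚ) → Set
Resp Φ = ∀ f g → (∀ v → f v ≡ g v) → Φ f ≡ Φ g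

Resp-∷ : ∀ {n s} {Φ : (Fin (suc n) → Fin s) → ℚ} → Resp Φ → ∀ a → Resp (λ f → Φ (a VF.∷ f))
Resp-∷ r a f g h = r _ _ λ { Fin.zero → refl ; (Fin.suc v) → h v }

∑-allMaps-suc : ∀ {n s} (Φ : (Fin (suc n) → Fin s) → ℚ) → Resp Φ →
  ∑ (allMaps (suc n) s) Φ ≡ ∑ (allFin s) (λ a → ∑ (allMaps n s) (λ f → Φ (a VF.∷ f)))
∑-allMaps-suc {n} {s} Φ r = trans (∑-concatMap _ (allFin s) Φ)
  (∑-cong (allFin s) (λ a → trans (∑-map _ (allMaps n s) Φ)
    (∑-cong (allMaps n s) (λ f → r _ _ λ { Fin.zero → refl ; (Fin.suc v) → refl }))))

-- `allMaps` chooses the color of vertex 0 outermost; here any vertex `v` is moved outermost. In the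
-- induction on `v` the color of vertex 0 stays outside while `v` is extracted from the rest, and
-- then the two color sums are interchanged.
∑-allMaps-insertAt : ∀ {n s} (v : Fin (suc n)) (Φ : (Fin (suc n) → Fin s) → ℚ) → Resp Φ →
  ∑ (allMaps (suc n) s) Φ ≡ ∑ (allFin s) (λ a → ∑ (allMaps n s) (λ f → Φ (insertAt f v a)))
∑-allMaps-insertAt {n} {s} Fin.zero Φ r = trans (∑-allMaps-suc Φ r)
  (∑-cong (allFin s) (λ a → ∑-cong (allMaps n s) (λ f → r _ _ λ { Fin.zero → refl ; (Fin.suc v) → refl })))
∑-allMaps-insertAt {suc n} {s} (Fin.suc v) Φ r = begin
  ∑ (allMaps (suc (suc n)) s) Φ
    ≡⟨ ∑-allMaps-suc Φ r ⟩
  ∑ (allFin s) (λ b → ∑ (allMaps (suc n) s) (λ f → Φ (b VF.∷ f)))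
    ≡⟨ ∑-cong (allFin s) (λ b → ∑-allMaps-insertAt v (λ f → Φ (b VF.∷ f)) (Resp-∷ r b)) ⟩
  ∑ (allFin s) (λ b → ∑ (allFin s) (λ a → ∑ (allMaps n s) (λ f → Φ (b VF.∷ insertAt f v a))))
    ≡⟨ ∑-swap (allFin s) (allFin s) (λ b a → ∑ (allMaps n s) (λ f → Φ (b VF.∷ insertAt f v a))) ⟩
  ∑ (allFin s) (λ a → ∑ (allFin s) (λ b → ∑ (allMaps n s) (λ f → Φ (b VF.∷ insertAt f v a))))
    ≡⟨ ∑-cong (allFin s) (λ a → ∑-cong (allFin s) (λ b → ∑-cong (allMaps n s) (λ f →
         r _ _ λ { Fin.zero → refl ; (Fin.suc w) → refl }))) ⟩
  ∑ (allFin s) (λ a → ∑ (allFin s) (λ b → ∑ (allMaps n s) (λ f → Φ (insertAt (b VF.∷ f) (Fin.suc v) a))))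
    ≡⟨ ∑-cong (allFin s) (λ a → sym (∑-allMaps-suc (λ f → Φ (insertAt f (Fin.suc v) a))
         (λ f g h → r _ _ (λ { Fin.zero → h Fin.zero ; (Fin.suc w) → insertAt-cong v a (h ∘ Fin.suc) w })))) ⟩
  ∑ (allFin s) (λ a → ∑ (allMaps (suc n) s) (λ f → Φ (insertAt f (Fin.suc v) a))) ∎
  where
  open ≡-Reasoning
  insertAt-cong : ∀ {n s} {f g : Fin n → Fin s} v a → (∀ w → f w ≡ g w) → ∀ w → insertAt f v a w ≡ insertAt g v a w
  insertAt-cong Fin.zero a h Fin.zero = refl
  insertAt-cong Fin.zero a h (Fin.suc w) = h w
  insertAt-cong {suc n} (Fin.suc v) a h Fin.zero = h Fin.zero
  insertAt-cong {suc n} (Fin.suc v) a h (Fin.suc w) = insertAt-cong v a (h ∘ Fin.suc) w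

-- Extracting vertex `π 0` on the left makes its color the color of vertex 0 in `f ∘ π`. What is
-- left is composition with `ρ`, the permutation `π` with 0 and its image removed, to which
-- induction applies.
∑-allMaps-permute : ∀ {n s} (π : Permutation′ n) (Φ : (Fin n → Fin s) → ℚ) → Resp Φ →
  ∑ (allMaps n s) (λ f → Φ (f ∘ (π ⟨$⟩ʳ_))) ≡ ∑ (allMaps n s) Φ
∑-allMaps-permute {zero} π Φ r = cong (_+ 0ℚ) (r _ _ λ ())
∑-allMaps-permute {suc n} {s} π Φ r = begin
  ∑ (allMaps (suc n) s) (λ f → Φ (f ∘ (π ⟨$⟩ʳ_)))
    ≡⟨ ∑-allMaps-insertAt (π ⟨$⟩ʳ Fin.zero) (λ f → Φ (f ∘ (π ⟨$⟩ʳ_))) (λ f g h → r _ _ (λ v → h (π ⟨$⟩ʳ v))) ⟩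
  ∑ (allFin s) (λ a → ∑ (allMaps n s) (λ f → Φ (insertAt f (π ⟨$⟩ʳ Fin.zero) a ∘ (π ⟨$⟩ʳ_))))
    ≡⟨ ∑-cong (allFin s) (λ a → ∑-cong (allMaps n s) (λ f → r _ _ (pointwise a f))) ⟩
  ∑ (allFin s) (λ a → ∑ (allMaps n s) (λ f → Φ (a VF.∷ (f ∘ (ρ ⟨$⟩ʳ_)))))
    ≡⟨ ∑-cong (allFin s) (λ a → ∑-allMaps-permute ρ (λ f → Φ (a VF.∷ f)) (Resp-∷ r a)) ⟩
  ∑ (allFin s) (λ a → ∑ (allMaps n s) (λ f → Φ (a VF.∷ f)))
    ≡⟨ ∑-allMaps-suc Φ r ⟨
  ∑ (allMaps (suc n) s) Φ ∎
  where
  open ≡-Reasoning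
  ρ = Perm.remove Fin.zero π
  pointwise : ∀ a f v → insertAt f (π ⟨$⟩ʳ Fin.zero) a (π ⟨$⟩ʳ v) ≡ (a VF.∷ (f ∘ (ρ ⟨$⟩ʳ_))) v
  pointwise a f Fin.zero = VFP.insertAt-lookup f (π ⟨$⟩ʳ Fin.zero) a
  pointwise a f (Fin.suc v) = trans (cong (insertAt f (π ⟨$⟩ʳ Fin.zero) a) (Perm.punchIn-permute π Fin.zero v))
    (VFP.insertAt-punchIn f (π ⟨$⟩ʳ Fin.zero) a (ρ ⟨$⟩ʳ v))

-- Takes the place of membership of `f` in `allMaps`, which may hold only up to pointwise equality.
term≤∑-allMaps : ∀ {n s} (f : Fin n → Fin s) (Φ : (Fin n → Fin s) → ℚ) → Resp Φ → (∀ g → 0ℚ ≤ Φ g) →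
  Φ f ≤ ∑ (allMaps n s) Φ
term≤∑-allMaps {zero} f Φ r h = ≤-reflexive (trans (r _ _ λ ()) (sym (+-identityʳ _)))
term≤∑-allMaps {suc n} {s} f Φ r h = begin
  Φ f ≡⟨ r _ _ (λ { Fin.zero → refl ; (Fin.suc v) → refl }) ⟩
  Φ (f Fin.zero VF.∷ (f ∘ Fin.suc)) ≤⟨ term≤∑-allMaps (f ∘ Fin.suc) (λ g → Φ (f Fin.zero VF.∷ g)) (Resp-∷ r _) (λ g → h _) ⟩
  ∑ (allMaps n s) (λ g → Φ (f Fin.zero VF.∷ g)) ≤⟨ term≤∑ (f Fin.zero) (λ a → ∑ (allMaps n s) (λ g → Φ (a VF.∷ g))) (λ a → 0≤∑ (allMaps n s) (λ g → h _)) ⟩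
  ∑ (allFin s) (λ a → ∑ (allMaps n s) (λ g → Φ (a VF.∷ g))) ≡⟨ ∑-allMaps-suc Φ r ⟨
  ∑ (allMaps (suc n) s) Φ ∎
  where open ≤-Reasoning

-- Class sizes and the existence of a coloring

HasClasses : ∀ {n s} → (Fin s → ℕ) → (Fin n → Fin s) → Set
HasClasses c f = ∀ i → classSize f i ≡ c i

classSize-∑ : ∀ {n s} (f : Fin n → Fin s) i → ℕ→ℚ (classSize f i) ≡ ∑ (allFin n) (λ v → δ (f v) i)
classSize-∑ {n} f i = length-filterᵇ (λ v → ⌊ f v FinP.≟ i ⌋) (allFin n)

classSize-permute : ∀ {n s} (π : Permutation′ n) (f : Fin n → Fin s) i → classSize (f ∘ (π ⟨$⟩ʳ_)) i ≡ classSize f i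
classSize-permute π f i = ℕ→ℚ-injective (trans (classSize-∑ (f ∘ (π ⟨$⟩ʳ_)) i)
  (trans (∑-permute π (λ v → δ (f v) i)) (sym (classSize-∑ f i))))

classSize-cong : ∀ {n s} (f g : Fin n → Fin s) → (∀ v → f v ≡ g v) → ∀ i → classSize f i ≡ classSize g i
classSize-cong {n} f g h i = ℕ→ℚ-injective (trans (classSize-∑ f i)
  (trans (∑-cong (allFin n) (λ v → cong (λ a → δ a i) (h v))) (sym (classSize-∑ g i))))

isCColoring-cong : ∀ {n s} (c : Fin s → ℕ) (f g : Fin n → Fin s) → (∀ i → classSize f i ≡ classSize g i) →
  isCColoring c f ≡ isCColoring c g
isCColoring-cong {s = s} c f g h = cong and (ListP.map-cong (λ i → cong (ℕ._≡ᵇ c i) (h i)) (allFin s))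

private
  and⁺ : ∀ {A : Set} (p : A → Bool) xs → (∀ x → p x ≡ true) → and (map p xs) ≡ true
  and⁺ p [] h = refl
  and⁺ p (x ∷ xs) h = cong₂ _∧_ (h x) (and⁺ p xs h)

  and⁻ : ∀ {s} (p : Fin s → Bool) → and (map p (allFin s)) ≡ true → ∀ i → p i ≡ true
  and⁻ {suc s} p e Fin.zero with p Fin.zero
  ... | true = refl
  and⁻ {suc s} p e (Fin.suc i) with p Fin.zero
  ... | true = and⁻ (p ∘ Fin.suc) (trans (cong and (trans (ListP.map-∘ (allFin s)) (cong (map p) (ListP.map-tabulate (λ i → i) Fin.suc)))) e) i

isCColoring⇒HasClasses : ∀ {n s} (c : Fin s → ℕ) (f : Fin n → Fin s) → isCColoring c f ≡ true → HasClasses c f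
isCColoring⇒HasClasses c f e i = ℕP.≡ᵇ⇒≡ _ _ (Equivalence.from T-≡ (and⁻ (λ i → classSize f i ℕ.≡ᵇ c i) e i))

HasClasses⇒isCColoring : ∀ {n s} (c : Fin s → ℕ) (f : Fin n → Fin s) → HasClasses c f → isCColoring c f ≡ true
HasClasses⇒isCColoring {s = s} c f h = and⁺ _ (allFin s) (λ i → Equivalence.to T-≡ (ℕP.≡⇒≡ᵇ _ _ (h i)))

-- Greedy choice: the first vertex takes any color whose class is not exhausted, and the other
-- vertices are colored with that class reduced by one. A class may become empty on the way, so the
-- induction runs over all natural sizes with the right total.
coloring-exists : ∀ n {s} (c : Fin s → ℕ) → ∑ (allFin s) (ℕ→ℚ ∘ c) ≡ ℕ→ℚ n → ∃ λ (f : Fin n → Fin s) → HasClasses c f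
coloring-exists zero c e = (λ ()) , λ i → sym (ℕP.n≤0⇒n≡0 (ℕ→ℚ-cancel-≤ (≤-trans (term≤∑ i (ℕ→ℚ ∘ c) (0≤ℕ ∘ c)) (≤-reflexive e))))
coloring-exists (suc n) {s} c e with FinP.any? (λ i → 1 ℕ.≤? c i)
... | no ¬h = contradiction (ℕ→ℚ-injective {0} {suc n} (trans (sym (trans (∑-cong (allFin s) (λ i → cong ℕ→ℚ (c≡0 i))) (∑-0 (allFin s)))) e)) λ ()
  where c≡0 : ∀ i → c i ≡ 0
        c≡0 i with c i in eq
        ... | zero = refl
        ... | suc k = contradiction (i , subst (1 ℕ.≤_) (sym eq) (ℕ.s≤s ℕ.z≤n)) ¬h
... | yes (a , 1≤ca) = (a VF.∷ f) , λ i → ℕ→ℚ-injective (begin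
    ℕ→ℚ (classSize (a VF.∷ f) i)                       ≡⟨ classSize-∑ (a VF.∷ f) i ⟩
    ∑ (allFin (suc n)) (λ v → δ ((a VF.∷ f) v) i)      ≡⟨ ∑-allFin-suc (λ v → δ ((a VF.∷ f) v) i) ⟩
    δ a i + ∑ (allFin n) (λ v → δ (f v) i)             ≡⟨ cong (δ a i +_) (classSize-∑ f i) ⟨
    δ a i + ℕ→ℚ (classSize f i)                        ≡⟨ cong (λ k → δ a i + ℕ→ℚ k) (proj₂ rec i) ⟩
    δ a i + ℕ→ℚ (c′ i)                                 ≡⟨ split i ⟨
    ℕ→ℚ (c i)                                          ∎)
  where
  open ≡-Reasoning
  c′ : _ → ℕ
  c′ i = if ⌊ a FinP.≟ i ⌋ then ℕ.pred (c i) else c i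
  suc-pred : ∀ k → 1 ℕ.≤ k → suc (ℕ.pred k) ≡ k
  suc-pred (suc k) _ = refl
  split : ∀ i → ℕ→ℚ (c i) ≡ δ a i + ℕ→ℚ (c′ i)
  split i with a FinP.≟ i
  ... | yes refl = trans (cong ℕ→ℚ (sym (suc-pred (c a) 1≤ca))) (ℕ→ℚ-+ 1 (ℕ.pred (c a)))
  ... | no _ = sym (+-identityˡ _)
  rec = coloring-exists n c′ (begin
    ∑ (allFin s) (ℕ→ℚ ∘ c′)                            ≡⟨ lem _ ⟩
    (1ℚ + ∑ (allFin s) (ℕ→ℚ ∘ c′)) - 1ℚ                ≡⟨ cong (λ t → (t + ∑ (allFin s) (ℕ→ℚ ∘ c′)) - 1ℚ) (∑-δ1 a) ⟨
    (∑ (allFin s) (δ a) + ∑ (allFin s) (ℕ→ℚ ∘ c′)) - 1ℚ ≡⟨ cong (_- 1ℚ) (∑-+ (allFin s) (δ a) (ℕ→ℚ ∘ c′)) ⟨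
    ∑ (allFin s) (λ i → δ a i + ℕ→ℚ (c′ i)) - 1ℚ       ≡⟨ cong (_- 1ℚ) (∑-cong (allFin s) split) ⟨
    ∑ (allFin s) (ℕ→ℚ ∘ c) - 1ℚ                        ≡⟨ cong (_- 1ℚ) (trans e (ℕ→ℚ-+ 1 n)) ⟩
    (1ℚ + ℕ→ℚ n) - 1ℚ                                  ≡⟨ lem (ℕ→ℚ n) ⟨
    ℕ→ℚ n                                              ∎)
    where lem : ∀ x → x ≡ (1ℚ + x) - 1ℚ
          lem = solve-∀ ℚ-ring
  f = proj₁ rec

-- Joint color probabilities of distinct vertices

transpose-fst : ∀ {n} (u w : Fin n) → Perm.transpose u w ⟨$⟩ʳ u ≡ w
transpose-fst u w rewrite dec-true (u FinP.≟ u) refl = refl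

transpose-fix : ∀ {n} (u w v : Fin n) → u ≢ v → w ≢ v → Perm.transpose u w ⟨$⟩ʳ v ≡ v
transpose-fix u w v u≢v w≢v rewrite dec-false (v FinP.≟ u) (u≢v ∘ sym) | dec-false (v FinP.≟ w) (w≢v ∘ sym) = refl

-- Indicator that every listed vertex has its prescribed color. Keeping the conditions in a list
-- lets a joint probability be peeled off one vertex at a time.
prod : ∀ {n s} → List (Fin n × Fin s) → (Fin n → Fin s) → ℚ
prod [] f = 1ℚ
prod ((v , i) ∷ ps) f = δ (f v) i * prod ps f

0≤δ : ∀ {n} (i j : Fin n) → 0ℚ ≤ δ i j
0≤δ i j = 0≤𝟙 ⌊ i FinP.≟ j ⌋

δ≤1 : ∀ {n} (i j : Fin n) → δ i j ≤ 1ℚ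
δ≤1 i j = 𝟙≤1 ⌊ i FinP.≟ j ⌋

*≤1 : ∀ {p q} → 0ℚ ≤ p → p ≤ 1ℚ → q ≤ 1ℚ → p * q ≤ 1ℚ
*≤1 hp hp′ hq = *-mono hp 0≤1 hp′ hq

0≤prod : ∀ {n s} (ps : List (Fin n × Fin s)) f → 0ℚ ≤ prod ps f
0≤prod [] f = 0≤1
0≤prod ((v , i) ∷ ps) f = 0≤* (0≤δ (f v) i) (0≤prod ps f)

prod≤1 : ∀ {n s} (ps : List (Fin n × Fin s)) f → prod ps f ≤ 1ℚ
prod≤1 [] f = ≤-refl
prod≤1 ((v , i) ∷ ps) f = *≤1 (0≤δ (f v) i) (δ≤1 (f v) i) (prod≤1 ps f)

Resp-prod : ∀ {n s} (ps : List (Fin n × Fin s)) → Resp (prod ps)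
Resp-prod [] f g h = refl
Resp-prod ((v , i) ∷ ps) f g h = cong₂ _*_ (cong (λ a → δ a i) (h v)) (Resp-prod ps f g h)

prod-transpose : ∀ {n s} (u w : Fin n) (ps : List (Fin n × Fin s)) →
  All (λ q → u ≢ proj₁ q) ps → All (λ q → w ≢ proj₁ q) ps →
  ∀ f → prod ps (f ∘ (Perm.transpose u w ⟨$⟩ʳ_)) ≡ prod ps f
prod-transpose u w [] [] [] f = refl
prod-transpose u w ((v , i) ∷ ps) (u≢v ∷ us) (w≢v ∷ ws) f =
  cong₂ _*_ (cong (λ z → δ (f z) i) (transpose-fix u w v u≢v w≢v)) (prod-transpose u w ps us ws f)

-- Number of unordered pairs of entries: 1, 3 and 6 for two, three and four vertices. It accumulates
-- the error `length ps` incurred each time a vertex is peeled off.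
pairErr : ∀ {A : Set} → List A → ℚ
pairErr [] = 0ℚ
pairErr (p ∷ ps) = ℕ→ℚ (length ps) + pairErr ps

0≤pairErr : ∀ {A : Set} (ps : List A) → 0ℚ ≤ pairErr ps
0≤pairErr [] = ≤-refl
0≤pairErr (p ∷ ps) = 0≤+ (0≤ℕ (length ps)) (0≤pairErr ps)

module Expectation {n s : ℕ} (c : Fin s → ℕ) (comp : ∑ (allFin s) (ℕ→ℚ ∘ c) ≡ ℕ→ℚ n) where

  L : List (Fin n → Fin s)
  L = cColorings n s c

  ∑L : ∀ X → ∑ L X ≡ ∑ (allMaps n s) (λ f → 𝟙 (isCColoring c f) * X f)
  ∑L X = ∑-filterᵇ (isCColoring c) (allMaps n s) X

  Resp-isCColoring : Resp {n} {s} (λ f → 𝟙 (isCColoring c f))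
  Resp-isCColoring f g h = cong 𝟙 (isCColoring-cong c f g (classSize-cong f g h))

  -- A `ratio` over an empty list would be 0, so without any coloring the expectation of a constant
  -- would not be that constant.
  1≤∣L∣ : 1 ℕ.≤ length L
  1≤∣L∣ = ℕ→ℚ-cancel-≤ (begin
    1ℚ                                            ≡⟨ cong 𝟙 (HasClasses⇒isCColoring c (proj₁ ex) (proj₂ ex)) ⟨
    𝟙 (isCColoring c (proj₁ ex))                  ≤⟨ term≤∑-allMaps (proj₁ ex) (λ f → 𝟙 (isCColoring c f)) Resp-isCColoring (λ g → 0≤𝟙 (isCColoring c g)) ⟩
    ∑ (allMaps n s) (λ f → 𝟙 (isCColoring c f))   ≡⟨ length-filterᵇ (isCColoring c) (allMaps n s) ⟨
    ℕ→ℚ (length L)                                ∎)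
    where open ≤-Reasoning
          ex = coloring-exists n c comp

  r : ℚ
  r = ratio 1 (length L)

  E : ((Fin n → Fin s) → ℚ) → ℚ
  E X = r * ∑ L X

  𝔼≡E : ∀ X → 𝔼 n s c X ≡ E (ℕ→ℚ ∘ X)
  𝔼≡E X = trans (ratio≡ _ _ 1≤∣L∣) (cong (r *_) (ℕ→ℚ-sum X L))

  Pr≡E : ∀ p → Pr n s c p ≡ E (𝟙 ∘ p)
  Pr≡E p = trans (ratio≡ _ _ 1≤∣L∣) (cong (r *_) (length-filterᵇ p L))

  -- The comparison is asked only on maps with the prescribed class sizes. Through `E-cong` this is
  -- how the constant number of vertices of color `i` enters `prod-step`.
  E-mono : ∀ {X Y} → (∀ f → HasClasses c f → X f ≤ Y f) → E X ≤ E Y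
  E-mono {X} {Y} h = *-monoˡ (0≤ratio 1 (length L)) (subst₂ _≤_ (sym (∑L X)) (sym (∑L Y)) (∑-mono (allMaps n s) step))
    where step : ∀ f → 𝟙 (isCColoring c f) * X f ≤ 𝟙 (isCColoring c f) * Y f
          step f with isCColoring c f in eq
          ... | true = *-monoˡ 0≤1 (h f (isCColoring⇒HasClasses c f eq))
          ... | false = ≤-reflexive (trans (*-zeroˡ (X f)) (sym (*-zeroˡ (Y f))))

  E-cong : ∀ {X Y} → (∀ f → HasClasses c f → X f ≡ Y f) → E X ≡ E Y
  E-cong {X} {Y} h = ≤-antisym (E-mono {X} {Y} (λ f k → ≤-reflexive (h f k))) (E-mono {Y} {X} (λ f k → ≤-reflexive (sym (h f k))))

  E-cong′ : ∀ {X Y} → (∀ f → X f ≡ Y f) → E X ≡ E Y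
  E-cong′ {X} {Y} h = E-cong {X} {Y} (λ f _ → h f)

  E-*ˡ : ∀ k X → E (λ f → k * X f) ≡ k * E X
  E-*ˡ k X = trans (cong (r *_) (∑-*ˡ k L X)) (lem r k (∑ L X))
    where lem : ∀ r k x → r * (k * x) ≡ k * (r * x)
          lem = solve-∀ ℚ-ring

  E-*ʳ : ∀ k X → E (λ f → X f * k) ≡ E X * k
  E-*ʳ k X = trans (E-cong′ {λ f → X f * k} {λ f → k * X f} (λ f → *-comm (X f) k)) (trans (E-*ˡ k X) (*-comm k (E X)))

  E-const : ∀ k → E (λ _ → k) ≡ k
  E-const k = begin
    r * ∑ L (λ _ → k)          ≡⟨ cong (r *_) (∑-const L k) ⟩
    r * (ℕ→ℚ (length L) * k)   ≡⟨ *-assoc r (ℕ→ℚ (length L)) k ⟨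
    r * ℕ→ℚ (length L) * k     ≡⟨ cong (_* k) (ratio-* 1 (length L) 1≤∣L∣) ⟩
    1ℚ * k                     ≡⟨ *-identityˡ k ⟩
    k                          ∎
    where open ≡-Reasoning

  E-- : ∀ X Y → E (λ f → X f - Y f) ≡ E X - E Y
  E-- X Y = trans (cong (r *_) (∑-- L X Y)) (lem r (∑ L X) (∑ L Y))
    where lem : ∀ r x y → r * (x - y) ≡ r * x - r * y
          lem = solve-∀ ℚ-ring

  E-∑ : ∀ {A : Set} (xs : List A) (X : A → (Fin n → Fin s) → ℚ) → E (λ f → ∑ xs (λ x → X x f)) ≡ ∑ xs (λ x → E (X x))
  E-∑ xs X = trans (cong (r *_) (∑-swap L xs (λ f x → X x f))) (sym (∑-*ˡ r xs (λ x → ∑ L (X x))))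

  0≤E : ∀ {X} → (∀ f → 0ℚ ≤ X f) → 0ℚ ≤ E X
  0≤E {X} h = subst (_≤ E X) (E-const 0ℚ) (E-mono {λ _ → 0ℚ} {X} (λ f _ → h f))

  E≤ : ∀ {X k} → (∀ f → X f ≤ k) → E X ≤ k
  E≤ {X} {k} h = subst (E X ≤_) (E-const k) (E-mono {X} {λ _ → k} (λ f _ → h f))

  -- A permutation of the vertices preserves class sizes, so the filter that cuts the colorings out
  -- of all maps is invariant too.
  E-permute : ∀ (π : Permutation′ n) X → Resp X → E (λ f → X (f ∘ (π ⟨$⟩ʳ_))) ≡ E X
  E-permute π X resp = cong (r *_) (begin
    ∑ L (λ f → X (f ∘ (π ⟨$⟩ʳ_)))
      ≡⟨ ∑L (λ f → X (f ∘ (π ⟨$⟩ʳ_))) ⟩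
    ∑ (allMaps n s) (λ f → 𝟙 (isCColoring c f) * X (f ∘ (π ⟨$⟩ʳ_)))
      ≡⟨ ∑-cong (allMaps n s) (λ f → cong (λ b → 𝟙 b * X (f ∘ (π ⟨$⟩ʳ_)))
           (isCColoring-cong c f (f ∘ (π ⟨$⟩ʳ_)) (λ i → sym (classSize-permute π f i)))) ⟩
    ∑ (allMaps n s) (λ f → 𝟙 (isCColoring c (f ∘ (π ⟨$⟩ʳ_))) * X (f ∘ (π ⟨$⟩ʳ_)))
      ≡⟨ ∑-allMaps-permute π (λ f → 𝟙 (isCColoring c f) * X f) (λ f g h → cong₂ _*_ (Resp-isCColoring f g h) (resp f g h)) ⟩
    ∑ (allMaps n s) (λ f → 𝟙 (isCColoring c f) * X f)
      ≡⟨ ∑L X ⟨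
    ∑ L X ∎)
    where open ≡-Reasoning

  module Moments (1≤n : 1 ℕ.≤ n) where
    η : ℚ
    η = ratio 1 n

    x : Fin s → ℚ
    x i = η * ℕ→ℚ (c i)

    0≤η : 0ℚ ≤ η
    0≤η = 0≤ratio 1 n

    η*n : η * ℕ→ℚ n ≡ 1ℚ
    η*n = ratio-* 1 n 1≤n

    0≤x : ∀ i → 0ℚ ≤ x i
    0≤x i = 0≤* 0≤η (0≤ℕ (c i))

    ∑x : ∑ (allFin s) x ≡ 1ℚ
    ∑x = trans (∑-*ˡ η (allFin s) (ℕ→ℚ ∘ c)) (trans (cong (η *_) comp) η*n)

    x≤1 : ∀ i → x i ≤ 1ℚ
    x≤1 i = subst (x i ≤_) ∑x (term≤∑ i x 0≤x)

    xprod : List (Fin n × Fin s) → ℚ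
    xprod [] = 1ℚ
    xprod ((v , i) ∷ ps) = x i * xprod ps

    -- If `w` is outside `ps`, transposing `u` and `w` leaves the other conditions alone, and
    -- exchangeability makes the difference zero. If `w` occurs in `ps`, the right side is at least
    -- 1, which bounds the difference of two numbers in [0,1].
    swap-bound : ∀ u i ps → All (λ q → u ≢ proj₁ q) ps → ∀ w →
      ∣ E (prod ((u , i) ∷ ps)) - E (prod ((w , i) ∷ ps)) ∣ ≤ ∑ ps (λ q → δ (proj₁ q) w)
    swap-bound u i ps us w with Any.any? (λ q → w FinP.≟ proj₁ q) ps
    ... | yes w∈ps = ≤-trans
          (∣x-y∣≤ (0≤E (0≤prod ((u , i) ∷ ps))) (E≤ {prod ((u , i) ∷ ps)} (prod≤1 ((u , i) ∷ ps)))
                  (0≤E (0≤prod ((w , i) ∷ ps))) (E≤ {prod ((w , i) ∷ ps)} (prod≤1 ((w , i) ∷ ps))))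
          (count w∈ps)
      where count : ∀ {ps : List (Fin n × Fin s)} → Any (λ q → w ≡ proj₁ q) ps → 1ℚ ≤ ∑ ps (λ q → δ (proj₁ q) w)
            count {q ∷ ps} (here e) = subst (_≤ δ (proj₁ q) w + ∑ ps (λ q → δ (proj₁ q) w)) (+-identityʳ 1ℚ)
              (+-mono-≤ (≤-reflexive (sym (δ-≡ (sym e)))) (0≤∑ ps (λ q → 0≤δ (proj₁ q) w)))
            count {q ∷ ps} (there h) = subst (_≤ δ (proj₁ q) w + ∑ ps (λ q → δ (proj₁ q) w)) (+-identityˡ 1ℚ)
              (+-mono-≤ (0≤δ (proj₁ q) w) (count h))
    ... | no w∉ps = subst (_≤ ∑ ps (λ q → δ (proj₁ q) w)) (sym ∣∣≡0) (0≤∑ ps (λ q → 0≤δ (proj₁ q) w))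
      where
      π = Perm.transpose u w
      E≡ : E (prod ((w , i) ∷ ps)) ≡ E (prod ((u , i) ∷ ps))
      E≡ = trans (E-cong′ {prod ((w , i) ∷ ps)} (λ f → sym (cong₂ _*_ (cong (λ z → δ (f z) i) (transpose-fst u w))
              (prod-transpose u w ps us (AllP.¬Any⇒All¬ ps w∉ps) f))))
            (E-permute π (prod ((u , i) ∷ ps)) (Resp-prod ((u , i) ∷ ps)))
      ∣∣≡0 : ∣ E (prod ((u , i) ∷ ps)) - E (prod ((w , i) ∷ ps)) ∣ ≡ 0ℚ
      ∣∣≡0 = trans (cong (λ t → ∣ E (prod ((u , i) ∷ ps)) - t ∣) E≡) (cong ∣_∣ (+-inverseʳ (E (prod ((u , i) ∷ ps)))))

    -- Exactly `c i` vertices have color `i`, so `x i * E (prod ps)` is the mean of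
    -- `E (prod ((w , i) ∷ ps))` over all vertices `w`. Only a `w` listed in `ps` can make this term
    -- differ from the one for `u`.
    prod-step : ∀ u i ps → All (λ q → u ≢ proj₁ q) ps →
      ∣ E (prod ((u , i) ∷ ps)) - x i * E (prod ps) ∣ ≤ η * ℕ→ℚ (length ps)
    prod-step u i ps us = begin
      ∣ A - x i * E (prod ps) ∣
        ≡⟨ cong ∣_∣ identity ⟩
      ∣ η * ∑ (allFin n) (λ w → A - B w) ∣
        ≡⟨ trans (∣p*q∣≡∣p∣*∣q∣ η _) (cong (_* ∣ ∑ (allFin n) (λ w → A - B w) ∣) (0≤p⇒∣p∣≡p 0≤η)) ⟩
      η * ∣ ∑ (allFin n) (λ w → A - B w) ∣
        ≤⟨ *-monoˡ 0≤η (∣∑∣≤ (allFin n) (λ w → A - B w)) ⟩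
      η * ∑ (allFin n) (λ w → ∣ A - B w ∣)
        ≤⟨ *-monoˡ 0≤η (∑-mono (allFin n) (swap-bound u i ps us)) ⟩
      η * ∑ (allFin n) (λ w → ∑ ps (λ q → δ (proj₁ q) w))
        ≡⟨ cong (η *_) (∑-swap (allFin n) ps (λ w q → δ (proj₁ q) w)) ⟩
      η * ∑ ps (λ q → ∑ (allFin n) (δ (proj₁ q)))
        ≡⟨ cong (η *_) (∑-cong ps (λ q → ∑-δ1 (proj₁ q))) ⟩
      η * ∑ ps (λ q → 1ℚ)
        ≡⟨ cong (η *_) (trans (∑-const ps 1ℚ) (*-identityʳ (ℕ→ℚ (length ps)))) ⟩
      η * ℕ→ℚ (length ps) ∎
      where
      open ≤-Reasoning
      A = E (prod ((u , i) ∷ ps))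
      B : Fin n → ℚ
      B w = E (prod ((w , i) ∷ ps))
      ∑B : ∑ (allFin n) B ≡ ℕ→ℚ (c i) * E (prod ps)
      ∑B = begin-equality
        ∑ (allFin n) B                                                  ≡⟨ E-∑ (allFin n) (λ w → prod ((w , i) ∷ ps)) ⟨
        E (λ f → ∑ (allFin n) (λ w → δ (f w) i * prod ps f))            ≡⟨ E-cong {λ f → ∑ (allFin n) (λ w → δ (f w) i * prod ps f)} (λ f h →
             trans (∑-*ʳ (prod ps f) (allFin n) (λ w → δ (f w) i))
                   (cong (_* prod ps f) (trans (sym (classSize-∑ f i)) (cong ℕ→ℚ (h i))))) ⟩
        E (λ f → ℕ→ℚ (c i) * prod ps f)                                 ≡⟨ E-*ˡ (ℕ→ℚ (c i)) (prod ps) ⟩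
        ℕ→ℚ (c i) * E (prod ps)                                         ∎
      lem : ∀ A η k P → A * 1ℚ - (η * k) * P ≡ A * 1ℚ - η * (k * P)
      lem = solve-∀ ℚ-ring
      lem₂ : ∀ A η n S → A * (η * n) - η * S ≡ η * (n * A - S)
      lem₂ = solve-∀ ℚ-ring
      identity : A - x i * E (prod ps) ≡ η * ∑ (allFin n) (λ w → A - B w)
      identity = begin-equality
        A - x i * E (prod ps)                          ≡⟨ cong (_- x i * E (prod ps)) (*-identityʳ A) ⟨
        A * 1ℚ - x i * E (prod ps)                     ≡⟨ lem A η (ℕ→ℚ (c i)) (E (prod ps)) ⟩
        A * 1ℚ - η * (ℕ→ℚ (c i) * E (prod ps))         ≡⟨ cong₂ (λ a b → A * a - η * b) η*n ∑B ⟨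
        A * (η * ℕ→ℚ n) - η * ∑ (allFin n) B           ≡⟨ lem₂ A η (ℕ→ℚ n) (∑ (allFin n) B) ⟩
        η * (ℕ→ℚ n * A - ∑ (allFin n) B)               ≡⟨ cong (λ k → η * (ℕ→ℚ k * A - ∑ (allFin n) B)) (ListP.length-tabulate {n = n} (λ i → i)) ⟨
        η * (ℕ→ℚ (length (allFin n)) * A - ∑ (allFin n) B) ≡⟨ cong (λ t → η * (t - ∑ (allFin n) B)) (∑-const (allFin n) A) ⟨
        η * (∑ (allFin n) (λ _ → A) - ∑ (allFin n) B)  ≡⟨ cong (η *_) (∑-- (allFin n) (λ _ → A) B) ⟨
        η * ∑ (allFin n) (λ w → A - B w)               ∎

    -- The errors of `prod-step` add up along the list; since `x i ≤ 1`, the error already made on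
    -- the tail is not amplified.
    prod-approx : ∀ ps → AllPairs (λ p q → proj₁ p ≢ proj₁ q) ps →
      ∣ E (prod ps) - xprod ps ∣ ≤ η * pairErr ps
    prod-approx [] [] = ≤-reflexive (trans (cong (λ t → ∣ t - 1ℚ ∣) (E-const 1ℚ)) (sym (*-zeroʳ η)))
    prod-approx ((u , i) ∷ ps) (us ∷ ds) = begin
      ∣ E (prod ((u , i) ∷ ps)) - x i * xprod ps ∣
        ≤⟨ ∣∣-triangle (E (prod ((u , i) ∷ ps))) (x i * E (prod ps)) (x i * xprod ps) ⟩
      ∣ E (prod ((u , i) ∷ ps)) - x i * E (prod ps) ∣ + ∣ x i * E (prod ps) - x i * xprod ps ∣
        ≤⟨ +-mono-≤ (prod-step u i ps us) (≤-trans (≤-reflexive abs≡) (*-mono (0≤x i) (0≤* 0≤η (0≤pairErr ps)) (x≤1 i) (prod-approx ps ds))) ⟩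
      η * ℕ→ℚ (length ps) + 1ℚ * (η * pairErr ps)
        ≡⟨ lem η (ℕ→ℚ (length ps)) (pairErr ps) ⟩
      η * pairErr ((u , i) ∷ ps) ∎
      where
      open ≤-Reasoning
      lem : ∀ η k e → η * k + 1ℚ * (η * e) ≡ η * (k + e)
      lem = solve-∀ ℚ-ring
      lem₂ : ∀ x p q → x * p - x * q ≡ x * (p - q)
      lem₂ = solve-∀ ℚ-ring
      abs≡ : ∣ x i * E (prod ps) - x i * xprod ps ∣ ≡ x i * ∣ E (prod ps) - xprod ps ∣
      abs≡ = trans (cong ∣_∣ (lem₂ (x i) (E (prod ps)) (xprod ps)))
        (trans (∣p*q∣≡∣p∣*∣q∣ (x i) _) (cong (_* ∣ E (prod ps) - xprod ps ∣) (0≤p⇒∣p∣≡p (0≤x i))))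

-- Covariances of edge indicators

∣∣-product : ∀ a b a′ b′ {ε ε′} → 0ℚ ≤ a′ → a′ ≤ 1ℚ → 0ℚ ≤ b → b ≤ 1ℚ →
  ∣ a - b ∣ ≤ ε → ∣ a′ - b′ ∣ ≤ ε′ → ∣ a * a′ - b * b′ ∣ ≤ ε + ε′
∣∣-product a b a′ b′ {ε} {ε′} ha ha′ hb hb′ h h′ = begin
  ∣ a * a′ - b * b′ ∣                         ≡⟨ cong ∣_∣ (lem a b a′ b′) ⟩
  ∣ (a - b) * a′ + b * (a′ - b′) ∣            ≤⟨ ∣p+q∣≤∣p∣+∣q∣ ((a - b) * a′) (b * (a′ - b′)) ⟩
  ∣ (a - b) * a′ ∣ + ∣ b * (a′ - b′) ∣        ≡⟨ cong₂ _+_ (trans (∣p*q∣≡∣p∣*∣q∣ (a - b) a′) (cong (∣ a - b ∣ *_) (0≤p⇒∣p∣≡p ha)))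
                                                          (trans (∣p*q∣≡∣p∣*∣q∣ b (a′ - b′)) (cong (_* ∣ a′ - b′ ∣) (0≤p⇒∣p∣≡p hb))) ⟩
  ∣ a - b ∣ * a′ + b * ∣ a′ - b′ ∣            ≤⟨ +-mono-≤ (*-mono (0≤∣p∣ (a - b)) 0≤1 ≤-refl ha′) (*-mono hb (0≤∣p∣ (a′ - b′)) hb′ ≤-refl) ⟩
  ∣ a - b ∣ * 1ℚ + 1ℚ * ∣ a′ - b′ ∣           ≡⟨ cong₂ _+_ (*-identityʳ ∣ a - b ∣) (*-identityˡ ∣ a′ - b′ ∣) ⟩
  ∣ a - b ∣ + ∣ a′ - b′ ∣                     ≤⟨ +-mono-≤ h h′ ⟩
  ε + ε′                                      ∎
  where
  open ≤-Reasoning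
  lem : ∀ a b a′ b′ → a * a′ - b * b′ ≡ (a - b) * a′ + b * (a′ - b′)
  lem = solve-∀ ℚ-ring

-- For pairs with distinct endpoints, `incidences` counts the common endpoints, and `coincidences`
-- is 1 exactly when the pairs agree as unordered edges. Equal edges thus have two incidences and
-- one coincidence.
incidences coincidences : ∀ {n} → Fin n × Fin n → Fin n × Fin n → ℚ
incidences (u , v) (u′ , v′) = δ u u′ + δ u v′ + δ v u′ + δ v v′
coincidences (u , v) (u′ , v′) = δ u u′ * δ v v′ + δ u v′ * δ v u′

Z : ∀ {n s} → Fin s → Fin n × Fin n → (Fin n → Fin s) → ℚ
Z i (u , v) f = δ (f u) i * δ (f v) i

0≤Z : ∀ {n s} (i : Fin s) (e : Fin n × Fin n) f → 0ℚ ≤ Z i e f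
0≤Z i (u , v) f = 0≤* (0≤δ (f u) i) (0≤δ (f v) i)

Z≤1 : ∀ {n s} (i : Fin s) (e : Fin n × Fin n) f → Z i e f ≤ 1ℚ
Z≤1 i (u , v) f = *≤1 (0≤δ (f u) i) (δ≤1 (f u) i) (δ≤1 (f v) i)

Z-swap : ∀ {n s} (i : Fin s) (u v : Fin n) f → Z i (u , v) f ≡ Z i (v , u) f
Z-swap i u v f = *-comm (δ (f u) i) (δ (f v) i)

module Covariance {n s : ℕ} (c : Fin s → ℕ) (comp : ∑ (allFin s) (ℕ→ℚ ∘ c) ≡ ℕ→ℚ n) (1≤n : 1 ℕ.≤ n) where
  open Expectation {n} {s} c comp
  open Moments 1≤n

  cov : (X Y : (Fin n → Fin s) → ℚ) → ℚ
  cov X Y = E (λ f → X f * Y f) - E X * E Y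

  cov-cong : ∀ {X X′ Y Y′} → (∀ f → X f ≡ X′ f) → (∀ f → Y f ≡ Y′ f) → cov X Y ≡ cov X′ Y′
  cov-cong {X} {X′} {Y} {Y′} h k = cong₂ _-_
    (E-cong′ {λ f → X f * Y f} {λ f → X′ f * Y′ f} (λ f → cong₂ _*_ (h f) (k f))) (cong₂ _*_ (E-cong′ {X} {X′} h) (E-cong′ {Y} {Y′} k))

  V : Fin s → Fin s → ℚ
  V i j = δ i j * (x i * x i * x i) - (x i * x i) * (x j * x j)

  0≤x² : ∀ i → 0ℚ ≤ x i * x i
  0≤x² i = 0≤p² (x i)

  x²≤1 : ∀ i → x i * x i ≤ 1ℚ
  x²≤1 i = *≤1 (0≤x i) (x≤1 i) (x≤1 i)

  ∣V∣≤1 : ∀ i j → ∣ V i j ∣ ≤ 1ℚ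
  ∣V∣≤1 i j = ∣x-y∣≤ (0≤* (0≤δ i j) (0≤* (0≤x² i) (0≤x i))) (*≤1 (0≤δ i j) (δ≤1 i j) (*≤1 (0≤x² i) (x²≤1 i) (x≤1 i)))
                    (0≤* (0≤x² i) (0≤x² j)) (*≤1 (0≤x² i) (x²≤1 i) (x²≤1 j))

  EZ-approx : ∀ i {u v} → u ≢ v → ∣ E (Z i (u , v)) - x i * x i ∣ ≤ η
  EZ-approx i {u} {v} u≢v = subst₂ _≤_
    (cong₂ (λ a b → ∣ a - b ∣) (E-cong′ {prod ((u , i) ∷ (v , i) ∷ [])} (λ f → cong (δ (f u) i *_) (*-identityʳ (δ (f v) i))))
      (cong (x i *_) (*-identityʳ (x i))))
    (*-identityʳ η)
    (prod-approx ((u , i) ∷ (v , i) ∷ []) ((u≢v ∷ []) ∷ [] ∷ []))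

  EZ-product-approx : ∀ i j {u v u′ v′} → u ≢ v → u′ ≢ v′ →
    ∣ E (Z i (u , v)) * E (Z j (u′ , v′)) - (x i * x i) * (x j * x j) ∣ ≤ η + η
  EZ-product-approx i j {u} {v} {u′} {v′} h h′ = ∣∣-product (E (Z i (u , v))) (x i * x i) (E (Z j (u′ , v′))) (x j * x j)
    (0≤E (0≤Z j (u′ , v′))) (E≤ {Z j (u′ , v′)} (Z≤1 j (u′ , v′))) (0≤x² i) (x²≤1 i) (EZ-approx i h) (EZ-approx j h′)

  cov-approx : ∀ p q m t {ε} → ∣ p - m ∣ ≤ ε → ∣ q - t ∣ ≤ η + η → ∣ (p - q) - (m - t) ∣ ≤ ε + (η + η)
  cov-approx p q m t h h′ = ≤-trans
    (≤-trans (≤-reflexive (cong ∣_∣ (lem p q m t))) (∣p-q∣≤∣p∣+∣q∣ (p - m) (q - t))) (+-mono-≤ h h′)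
    where lem : ∀ p q m t → (p - q) - (m - t) ≡ (p - m) - (q - t)
          lem = solve-∀ ℚ-ring

  -- Four distinct vertices cost 6 units of `η` in the joint probability, and the product of the two
  -- means costs 2 more. A shared endpoint costs only 3 + 2, which is absorbed into the same
  -- constant.
  K₈ : ℚ
  K₈ = ℕ→ℚ 8

  -- At the common vertex `u` the colors `i` and `j` conflict unless they agree, whence the factor
  -- `δ i j`. When they agree, the product of the two edge indicators is an indicator for three
  -- distinct vertices.
  cov-shared : ∀ i j {u v w} → u ≢ v → u ≢ w → v ≢ w → ∣ cov (Z i (u , v)) (Z j (u , w)) - V i j ∣ ≤ K₈ * η
  cov-shared i j {u} {v} {w} u≢v u≢w v≢w = ≤-trans (cov-approx (E (λ f → Z i (u , v) f * Z j (u , w) f)) (E (Z i (u , v)) * E (Z j (u , w)))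
        (δ i j * (x i * x i * x i)) ((x i * x i) * (x j * x j)) main (EZ-product-approx i j u≢v u≢w))
      (≤-trans (≤-reflexive (lem η (ℕ→ℚ 3))) (*-monoʳ 0≤η (toWitness {a? = ℕ→ℚ 3 + 1ℚ + 1ℚ ≤? K₈} tt)))
    where
    lem : ∀ η k → k * η + (η + η) ≡ (k + 1ℚ + 1ℚ) * η
    lem = solve-∀ ℚ-ring
    open ≤-Reasoning
    ps = (u , i) ∷ (v , i) ∷ (w , i) ∷ []
    pointwise : ∀ f → Z i (u , v) f * Z j (u , w) f ≡ δ i j * prod ps f
    pointwise f with i FinP.≟ j
    pointwise f | yes refl with f u FinP.≟ i
    ... | yes _ = l1 (δ (f v) i) (δ (f w) i)
      where l1 : ∀ a b → 1ℚ * a * (1ℚ * b) ≡ 1ℚ * (1ℚ * (a * (b * 1ℚ)))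
            l1 = solve-∀ ℚ-ring
    ... | no _ = l2 (δ (f v) i) (δ (f w) i)
      where l2 : ∀ a b → 0ℚ * a * (0ℚ * b) ≡ 1ℚ * (0ℚ * (a * (b * 1ℚ)))
            l2 = solve-∀ ℚ-ring
    pointwise f | no i≢j with f u FinP.≟ i
    ... | no _ = l3 (δ (f v) i) (δ (f u) j * δ (f w) j) (0ℚ * (δ (f v) i * (δ (f w) i * 1ℚ)))
      where l3 : ∀ a b t → 0ℚ * a * b ≡ 0ℚ * t
            l3 = solve-∀ ℚ-ring
    ... | yes fu≡i = trans (cong (λ t → 1ℚ * δ (f v) i * (t * δ (f w) j)) (δ-≢ (λ fu≡j → i≢j (trans (sym fu≡i) fu≡j))))
                       (l4 (δ (f v) i) (δ (f w) j) (1ℚ * (δ (f v) i * (δ (f w) i * 1ℚ))))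
      where l4 : ∀ a b t → 1ℚ * a * (0ℚ * b) ≡ 0ℚ * t
            l4 = solve-∀ ℚ-ring
    l5 : ∀ d a b → d * a - d * b ≡ d * (a - b)
    l5 = solve-∀ ℚ-ring
    l6 : ∀ a → a * a * a ≡ a * (a * (a * 1ℚ))
    l6 = solve-∀ ℚ-ring
    main : ∣ E (λ f → Z i (u , v) f * Z j (u , w) f) - δ i j * (x i * x i * x i) ∣ ≤ ℕ→ℚ 3 * η
    main = begin
      ∣ E (λ f → Z i (u , v) f * Z j (u , w) f) - δ i j * (x i * x i * x i) ∣
        ≡⟨ cong₂ (λ a b → ∣ a - δ i j * b ∣) (trans (E-cong′ {λ f → Z i (u , v) f * Z j (u , w) f} pointwise) (E-*ˡ (δ i j) (prod ps))) (l6 (x i)) ⟩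
      ∣ δ i j * E (prod ps) - δ i j * xprod ps ∣
        ≡⟨ trans (cong ∣_∣ (l5 (δ i j) (E (prod ps)) (xprod ps))) (∣p*q∣≡∣p∣*∣q∣ (δ i j) (E (prod ps) - xprod ps)) ⟩
      ∣ δ i j ∣ * ∣ E (prod ps) - xprod ps ∣
        ≤⟨ *-mono (0≤∣p∣ (δ i j)) (0≤* 0≤η (0≤ℕ 3)) (≤-trans (≤-reflexive (0≤p⇒∣p∣≡p (0≤δ i j))) (δ≤1 i j))
             (prod-approx ps ((u≢v ∷ u≢w ∷ []) ∷ (v≢w ∷ []) ∷ [] ∷ [])) ⟩
      1ℚ * (η * ℕ→ℚ 3)
        ≡⟨ trans (*-identityˡ (η * ℕ→ℚ 3)) (*-comm η (ℕ→ℚ 3)) ⟩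
      ℕ→ℚ 3 * η ∎

  cov-disjoint : ∀ i j {u v u′ v′} → u ≢ v → u ≢ u′ → u ≢ v′ → v ≢ u′ → v ≢ v′ → u′ ≢ v′ →
    ∣ cov (Z i (u , v)) (Z j (u′ , v′)) ∣ ≤ K₈ * η
  cov-disjoint i j {u} {v} {u′} {v′} h₁ h₂ h₃ h₄ h₅ h₆ = subst₂ _≤_
      (cong ∣_∣ (l1 (cov (Z i (u , v)) (Z j (u′ , v′))) ((x i * x i) * (x j * x j)))) (lem η (ℕ→ℚ 6))
      (cov-approx (E (λ f → Z i (u , v) f * Z j (u′ , v′) f)) (E (Z i (u , v)) * E (Z j (u′ , v′)))
        ((x i * x i) * (x j * x j)) ((x i * x i) * (x j * x j)) main (EZ-product-approx i j h₁ h₆))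
    where
    ps = (u , i) ∷ (v , i) ∷ (u′ , j) ∷ (v′ , j) ∷ []
    lem : ∀ η k → k * η + (η + η) ≡ (k + 1ℚ + 1ℚ) * η
    lem = solve-∀ ℚ-ring
    l1 : ∀ a b → a - (b - b) ≡ a
    l1 = solve-∀ ℚ-ring
    l2 : ∀ a b c d → a * (b * (c * (d * 1ℚ))) ≡ (a * b) * (c * d)
    l2 = solve-∀ ℚ-ring
    main : ∣ E (λ f → Z i (u , v) f * Z j (u′ , v′) f) - (x i * x i) * (x j * x j) ∣ ≤ ℕ→ℚ 6 * η
    main = subst₂ _≤_
      (cong₂ (λ a b → ∣ a - b ∣) (E-cong′ {prod ps} (λ f → l2 (δ (f u) i) (δ (f v) i) (δ (f u′) j) (δ (f v′) j))) (l2 (x i) (x i) (x j) (x j)))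
      (*-comm η (ℕ→ℚ 6))
      (prod-approx ps ((h₁ ∷ h₂ ∷ h₃ ∷ []) ∷ (h₄ ∷ h₅ ∷ []) ∷ (h₆ ∷ []) ∷ [] ∷ []))

  -- Serves equal edges: they have two incidences but span only two vertices, so the three-vertex
  -- formula behind `V` is not valid and the crude bound 1 + 1 + 1 replaces it.
  ∣cov-2V∣≤3 : ∀ i j e e′ → ∣ cov (Z i e) (Z j e′) - (1ℚ + 1ℚ) * V i j ∣ ≤ ℕ→ℚ 3
  ∣cov-2V∣≤3 i j e e′ = begin
    ∣ cov (Z i e) (Z j e′) - (1ℚ + 1ℚ) * V i j ∣        ≡⟨ cong ∣_∣ (lem (cov (Z i e) (Z j e′)) (V i j)) ⟩
    ∣ (cov (Z i e) (Z j e′) - V i j) - V i j ∣          ≤⟨ ∣p-q∣≤∣p∣+∣q∣ (cov (Z i e) (Z j e′) - V i j) (V i j) ⟩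
    ∣ cov (Z i e) (Z j e′) - V i j ∣ + ∣ V i j ∣        ≤⟨ +-monoˡ-≤ ∣ V i j ∣ (∣p-q∣≤∣p∣+∣q∣ (cov (Z i e) (Z j e′)) (V i j)) ⟩
    ∣ cov (Z i e) (Z j e′) ∣ + ∣ V i j ∣ + ∣ V i j ∣    ≤⟨ +-mono-≤ (+-mono-≤ cov≤1 (∣V∣≤1 i j)) (∣V∣≤1 i j) ⟩
    ℕ→ℚ 3                                               ∎
    where
    open ≤-Reasoning
    lem : ∀ a v → a - (1ℚ + 1ℚ) * v ≡ (a - v) - v
    lem = solve-∀ ℚ-ring
    cov≤1 : ∣ cov (Z i e) (Z j e′) ∣ ≤ 1ℚ
    cov≤1 = ∣x-y∣≤ (0≤E (λ f → 0≤* (0≤Z i e f) (0≤Z j e′ f))) (E≤ {λ f → Z i e f * Z j e′ f} (λ f → *≤1 (0≤Z i e f) (Z≤1 i e f) (Z≤1 j e′ f)))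
             (0≤* (0≤E (0≤Z i e)) (0≤E (0≤Z j e′))) (*≤1 (0≤E (0≤Z i e)) (E≤ {Z i e} (Z≤1 i e)) (E≤ {Z j e′} (Z≤1 j e′)))

  -- Each way of sharing one endpoint reduces to `cov-shared` after the edges are reoriented so that
  -- the shared endpoint stands first. Edges that agree in both endpoints fall under the crude
  -- bound, which the coincidence term pays for.
  cov-pair : ∀ i j e e′ → proj₁ e ≢ proj₂ e → proj₁ e′ ≢ proj₂ e′ →
    ∣ cov (Z i e) (Z j e′) - incidences e e′ * V i j ∣ ≤ K₈ * η + ℕ→ℚ 3 * coincidences e e′
  cov-pair i j e@(u , v) e′@(u′ , v′) u≢v u′≢v′ = cases (u FinP.≟ u′) (u FinP.≟ v′) (v FinP.≟ u′) (v FinP.≟ v′)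
    where
    C = cov (Z i e) (Z j e′)
    Bound : ℚ → ℚ → ℚ → ℚ → Set
    Bound a b c d = ∣ C - (a + b + c + d) * V i j ∣ ≤ K₈ * η + ℕ→ℚ 3 * (a * d + b * c)
    -- Once the four indicators are replaced by literal zeros and ones, the numbers of incidences
    -- and coincidences evaluate by computation.
    transport : ∀ {a b c d} → a ≡ δ u u′ → b ≡ δ u v′ → c ≡ δ v u′ → d ≡ δ v v′ → Bound a b c d →
      Bound (δ u u′) (δ u v′) (δ v u′) (δ v v′)
    transport refl refl refl refl h = h
    0≤K : 0ℚ ≤ K₈ * η
    0≤K = 0≤* (0≤ℕ 8) 0≤η
    yes! : ∀ {n} {a b : Fin n} → a ≡ b → 1ℚ ≡ δ a b
    yes! e = sym (δ-≡ e)
    no! : ∀ {n} {a b : Fin n} → a ≢ b → 0ℚ ≡ δ a b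
    no! e = sym (δ-≢ e)
    equal : ∣ C - (1ℚ + 1ℚ) * V i j ∣ ≤ K₈ * η + ℕ→ℚ 3
    equal = ≤-trans (∣cov-2V∣≤3 i j e e′) (≤-trans (≤-reflexive (sym (+-identityˡ (ℕ→ℚ 3)))) (+-monoˡ-≤ (ℕ→ℚ 3) 0≤K))
    shared : ∣ C - V i j ∣ ≤ K₈ * η → ∣ C - 1ℚ * V i j ∣ ≤ K₈ * η + 0ℚ
    shared = subst₂ (λ a b → ∣ C - a ∣ ≤ b) (sym (*-identityˡ (V i j))) (sym (+-identityʳ (K₈ * η)))
    disjoint : ∣ C ∣ ≤ K₈ * η → ∣ C - 0ℚ * V i j ∣ ≤ K₈ * η + 0ℚ
    disjoint = subst₂ (λ a b → ∣ a ∣ ≤ b) (lem C (V i j)) (sym (+-identityʳ (K₈ * η)))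
      where lem : ∀ c v → c ≡ c - 0ℚ * v
            lem = solve-∀ ℚ-ring
    cases : Dec (u ≡ u′) → Dec (u ≡ v′) → Dec (v ≡ u′) → Dec (v ≡ v′) →
      ∣ C - incidences e e′ * V i j ∣ ≤ K₈ * η + ℕ→ℚ 3 * coincidences e e′
    cases (yes p) _ _ (yes q) = transport (yes! p) (no! (λ h → u≢v (trans h (sym q)))) (no! (λ h → u≢v (trans p (sym h)))) (yes! q) equal
    cases (yes refl) _ _ (no q) = transport (yes! {a = u} refl) (no! u′≢v′) (no! (u≢v ∘ sym)) (no! q) (shared (cov-shared i j u≢v u′≢v′ q))
    cases (no p) (yes q) (yes r) _ = transport (no! p) (yes! q) (yes! r) (no! (λ h → u≢v (trans q (sym h)))) equal
    cases (no p) (yes refl) (no r) _ = transport (no! p) (yes! {a = u} refl) (no! r) (no! (u≢v ∘ sym))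
      (shared (subst (λ t → ∣ t - V i j ∣ ≤ K₈ * η) (cov-cong {Z i (u , v)} {Z i (u , v)} (λ f → refl) (Z-swap j u u′)) (cov-shared i j u≢v p r)))
    cases (no p) (no q) (yes refl) _ = transport (no! p) (no! q) (yes! {a = v} refl) (no! u′≢v′)
      (shared (subst (λ t → ∣ t - V i j ∣ ≤ K₈ * η) (cov-cong {Z i (v , u)} {Z i (u , v)} {Z j (v , v′)} (Z-swap i v u) (λ f → refl))
        (cov-shared i j (u≢v ∘ sym) u′≢v′ q)))
    cases (no p) (no q) (no r) (yes refl) = transport (no! p) (no! q) (no! r) (yes! {a = v} refl)
      (shared (subst (λ t → ∣ t - V i j ∣ ≤ K₈ * η) (cov-cong {Z i (v , u)} {Z i (u , v)} {Z j (v , u′)} (Z-swap i v u) (Z-swap j v u′))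
        (cov-shared i j (u≢v ∘ sym) r p)))
    cases (no p) (no q) (no r) (no t) = transport (no! p) (no! q) (no! r) (no! t) (disjoint (cov-disjoint i j u≢v p q r t u′≢v′))

-- Sums over edges, degrees and incidences

∑-mono-∈ : ∀ {A : Set} (xs : List A) {f g : A → ℚ} → (∀ {x} → x ∈ xs → f x ≤ g x) → ∑ xs f ≤ ∑ xs g
∑-mono-∈ [] h = ≤-refl
∑-mono-∈ (x ∷ xs) h = +-mono-≤ (h (here refl)) (∑-mono-∈ xs (h ∘ there))

∑-δˡ : ∀ {n} (i j : Fin n) → ∑ (allFin n) (λ w → δ w i * δ w j) ≡ δ i j
∑-δˡ {n} i j = trans (∑-cong (allFin n) (λ w → cong (_* δ w j) (δ-sym w i))) (∑-δ i (λ w → δ w j))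

-- Entry of the vertex-edge incidence matrix; the inner product of two of its columns is
-- `incidences`.
inc : ∀ {n} → Fin n → Fin n × Fin n → ℚ
inc w (u , v) = δ w u + δ w v

∑-inc : ∀ {n} (e e′ : Fin n × Fin n) → ∑ (allFin n) (λ w → inc w e * inc w e′) ≡ incidences e e′
∑-inc {n} (u , v) (u′ , v′) = begin
  ∑ (allFin n) (λ w → (δ w u + δ w v) * (δ w u′ + δ w v′))
    ≡⟨ ∑-cong (allFin n) (λ w → lem (δ w u) (δ w v) (δ w u′) (δ w v′)) ⟩
  ∑ (allFin n) (λ w → δ w u * δ w u′ + δ w u * δ w v′ + δ w v * δ w u′ + δ w v * δ w v′)
    ≡⟨ ∑-+ (allFin n) _ (λ w → δ w v * δ w v′) ⟩
  ∑ (allFin n) (λ w → δ w u * δ w u′ + δ w u * δ w v′ + δ w v * δ w u′) + ∑ (allFin n) (λ w → δ w v * δ w v′)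
    ≡⟨ cong₂ _+_ (trans (∑-+ (allFin n) _ (λ w → δ w v * δ w u′))
         (cong₂ _+_ (trans (∑-+ (allFin n) (λ w → δ w u * δ w u′) (λ w → δ w u * δ w v′))
           (cong₂ _+_ (∑-δˡ u u′) (∑-δˡ u v′))) (∑-δˡ v u′))) (∑-δˡ v v′) ⟩
  δ u u′ + δ u v′ + δ v u′ + δ v v′ ∎
  where
  open ≡-Reasoning
  lem : ∀ a b c d → (a + b) * (c + d) ≡ a * c + a * d + b * c + b * d
  lem = solve-∀ ℚ-ring

module GraphSums {n : ℕ} (G : Graph n) where
  ES : List (Fin n × Fin n)
  ES = edges G

  m : ℚ
  m = ℕ→ℚ (numEdges G)

  isEdge : Fin n × Fin n → Bool
  isEdge p = ⌊ proj₁ p Fin.<? proj₂ p ⌋ ∧ adj G (proj₁ p) (proj₂ p)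

  edge-≢ : ∀ {e} → e ∈ ES → proj₁ e ≢ proj₂ e
  edge-≢ {u , v} e∈ refl = FinP.<-irrefl {x = u} refl
    (toWitness {a? = u Fin.<? u} (proj₁ (Equivalence.to (T-∧ {⌊ u Fin.<? u ⌋} {adj G u u}) (proj₂ (∈-filter⁻ (T? ∘ isEdge) {xs = cartesianProduct (allFin n) (allFin n)} e∈)))))

  ∑-edges : ∀ φ → ∑ ES φ ≡ ∑ (allFin n) (λ u → ∑ (allFin n) (λ v → 𝟙 (isEdge (u , v)) * φ (u , v)))
  ∑-edges φ = trans (∑-filterᵇ isEdge (cartesianProduct (allFin n) (allFin n)) φ)
    (∑-cartesianProduct (allFin n) (allFin n) (λ p → 𝟙 (isEdge p) * φ p))

  -- Every edge is listed once, with its smaller endpoint first. The neighbors of `w` split into the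
  -- larger ones, where `w` is the first entry, and the smaller ones, where it is the second.
  degree-∑ : ∀ w → ∑ ES (inc w) ≡ ℕ→ℚ (degree G w)
  degree-∑ w = begin
    ∑ ES (inc w)
      ≡⟨ ∑-+ ES (λ e → δ w (proj₁ e)) (λ e → δ w (proj₂ e)) ⟩
    ∑ ES (λ e → δ w (proj₁ e)) + ∑ ES (λ e → δ w (proj₂ e))
      ≡⟨ cong₂ _+_ first second ⟩
    ∑ (allFin n) (λ v → 𝟙 (isEdge (w , v))) + ∑ (allFin n) (λ v → 𝟙 (isEdge (v , w)))
      ≡⟨ ∑-+ (allFin n) (λ v → 𝟙 (isEdge (w , v))) (λ v → 𝟙 (isEdge (v , w))) ⟨
    ∑ (allFin n) (λ v → 𝟙 (isEdge (w , v)) + 𝟙 (isEdge (v , w)))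
      ≡⟨ ∑-cong (allFin n) orient ⟩
    ∑ (allFin n) (λ v → 𝟙 (adj G w v))
      ≡⟨ length-filterᵇ (adj G w) (allFin n) ⟨
    ℕ→ℚ (degree G w) ∎
    where
    open ≡-Reasoning
    orient : ∀ v → 𝟙 (isEdge (w , v)) + 𝟙 (isEdge (v , w)) ≡ 𝟙 (adj G w v)
    orient v with w Fin.<? v | v Fin.<? w
    ... | yes w<v | yes v<w = contradiction v<w (FinP.<-asym w<v)
    ... | yes w<v | no _ = +-identityʳ (𝟙 (adj G w v))
    ... | no _ | yes v<w = trans (+-identityˡ (𝟙 (adj G v w))) (cong 𝟙 (Graph.sym G v w))
    ... | no w≮v | no v≮w with FinP.<-cmp w v
    ...   | tri< w<v _ _ = contradiction w<v w≮v
    ...   | tri> _ _ v<w = contradiction v<w v≮w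
    ...   | tri≈ _ refl _ = cong 𝟙 (sym (irrefl G w))
    first : ∑ ES (λ e → δ w (proj₁ e)) ≡ ∑ (allFin n) (λ v → 𝟙 (isEdge (w , v)))
    first = begin
      ∑ ES (λ e → δ w (proj₁ e))
        ≡⟨ ∑-edges (λ e → δ w (proj₁ e)) ⟩
      ∑ (allFin n) (λ u → ∑ (allFin n) (λ v → 𝟙 (isEdge (u , v)) * δ w u))
        ≡⟨ ∑-cong (allFin n) (λ u → trans (∑-*ʳ (δ w u) (allFin n) (λ v → 𝟙 (isEdge (u , v)))) (*-comm (∑ (allFin n) (λ v → 𝟙 (isEdge (u , v)))) (δ w u))) ⟩
      ∑ (allFin n) (λ u → δ w u * ∑ (allFin n) (λ v → 𝟙 (isEdge (u , v))))
        ≡⟨ ∑-δ w (λ u → ∑ (allFin n) (λ v → 𝟙 (isEdge (u , v)))) ⟩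
      ∑ (allFin n) (λ v → 𝟙 (isEdge (w , v))) ∎
    second : ∑ ES (λ e → δ w (proj₂ e)) ≡ ∑ (allFin n) (λ v → 𝟙 (isEdge (v , w)))
    second = trans (∑-edges (λ e → δ w (proj₂ e)))
      (∑-cong (allFin n) (λ u → trans (∑-cong (allFin n) (λ v → *-comm (𝟙 (isEdge (u , v))) (δ w v))) (∑-δ w (λ v → 𝟙 (isEdge (u , v))))))

  -- Expanding over the common vertex `w` turns the sum over pairs of edges into a sum over `w` of
  -- squared row sums of the incidence matrix, and these row sums are the degrees.
  ∑-incidences : ∑ ES (λ e → ∑ ES (incidences e)) ≡ ℕ→ℚ (Σ₂ G)
  ∑-incidences = begin
    ∑ ES (λ e → ∑ ES (incidences e))
      ≡⟨ ∑-cong ES (λ e → ∑-cong ES (λ e′ → sym (∑-inc e e′))) ⟩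
    ∑ ES (λ e → ∑ ES (λ e′ → ∑ (allFin n) (λ w → inc w e * inc w e′)))
      ≡⟨ ∑-cong ES (λ e → ∑-swap ES (allFin n) (λ e′ w → inc w e * inc w e′)) ⟩
    ∑ ES (λ e → ∑ (allFin n) (λ w → ∑ ES (λ e′ → inc w e * inc w e′)))
      ≡⟨ ∑-swap ES (allFin n) (λ e w → ∑ ES (λ e′ → inc w e * inc w e′)) ⟩
    ∑ (allFin n) (λ w → ∑ ES (λ e → ∑ ES (λ e′ → inc w e * inc w e′)))
      ≡⟨ ∑-cong (allFin n) (λ w → trans (∑-cong ES (λ e → ∑-*ˡ (inc w e) ES (inc w))) (∑-*ʳ (∑ ES (inc w)) ES (inc w))) ⟩
    ∑ (allFin n) (λ w → ∑ ES (inc w) * ∑ ES (inc w))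
      ≡⟨ ∑-cong (allFin n) (λ w → trans (cong₂ _*_ (degree-∑ w) (degree-∑ w)) (sym (ℕ→ℚ-* (degree G w) (degree G w)))) ⟩
    ∑ (allFin n) (λ w → ℕ→ℚ (degree G w ℕ.* degree G w))
      ≡⟨ ℕ→ℚ-sum (λ w → degree G w ℕ.* degree G w) (allFin n) ⟨
    ℕ→ℚ (Σ₂ G) ∎
    where open ≡-Reasoning

  -- The bound allows one match for each orientation of `e`; extending the sum from edges to all
  -- ordered pairs of vertices only increases it.
  ∑-coincidences : ∀ e → ∑ ES (coincidences e) ≤ 1ℚ + 1ℚ
  ∑-coincidences e@(u , v) = begin
    ∑ ES (coincidences e)
      ≡⟨ ∑-edges (coincidences e) ⟩
    ∑ (allFin n) (λ u′ → ∑ (allFin n) (λ v′ → 𝟙 (isEdge (u′ , v′)) * coincidences e (u′ , v′)))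
      ≤⟨ ∑-mono (allFin n) (λ u′ → ∑-mono (allFin n) (λ v′ →
           ≤-trans (*-monoʳ (0≤+ (0≤* (0≤δ u u′) (0≤δ v v′)) (0≤* (0≤δ u v′) (0≤δ v u′))) (𝟙≤1 (isEdge (u′ , v′))))
                   (≤-reflexive (*-identityˡ (coincidences e (u′ , v′)))))) ⟩
    ∑ (allFin n) (λ u′ → ∑ (allFin n) (λ v′ → δ u u′ * δ v v′ + δ u v′ * δ v u′))
      ≡⟨ ∑-cong (allFin n) (λ u′ → trans (∑-+ (allFin n) (λ v′ → δ u u′ * δ v v′) (λ v′ → δ u v′ * δ v u′))
           (cong₂ _+_ (∑-*ˡ (δ u u′) (allFin n) (δ v)) (∑-δ u (λ _ → δ v u′)))) ⟩
    ∑ (allFin n) (λ u′ → δ u u′ * ∑ (allFin n) (δ v) + δ v u′)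
      ≡⟨ ∑-+ (allFin n) (λ u′ → δ u u′ * ∑ (allFin n) (δ v)) (δ v) ⟩
    ∑ (allFin n) (λ u′ → δ u u′ * ∑ (allFin n) (δ v)) + ∑ (allFin n) (δ v)
      ≡⟨ cong₂ _+_ (trans (∑-δ u (λ _ → ∑ (allFin n) (δ v))) (∑-δ1 v)) (∑-δ1 v) ⟩
    1ℚ + 1ℚ ∎
    where open ≤-Reasoning

  Mi-∑ : ∀ {s} (i : Fin s) f → ℕ→ℚ (Mi G i f) ≡ ∑ ES (λ e → Z i e f)
  Mi-∑ i f = trans (length-filterᵇ (λ p → ⌊ f (proj₁ p) FinP.≟ i ⌋ ∧ ⌊ f (proj₂ p) FinP.≟ i ⌋) ES)
    (∑-cong ES (λ p → 𝟙-∧ ⌊ f (proj₁ p) FinP.≟ i ⌋ ⌊ f (proj₂ p) FinP.≟ i ⌋))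

  Mono-∑ : ∀ {s} (f : Fin n → Fin s) → ℕ→ℚ (Mono G f) ≡ ∑ (allFin s) (λ i → ℕ→ℚ (Mi G i f))
  Mono-∑ {s} f = ℕ→ℚ-sum (λ i → Mi G i f) (allFin s)

  -- The color of its first endpoint is the only class in which an edge can be counted. This makes
  -- the truncated subtraction in `Bi` a genuine difference.
  Mono≤m : ∀ {s} (f : Fin n → Fin s) → Mono G f ℕ.≤ numEdges G
  Mono≤m {s} f = ℕ→ℚ-cancel-≤ (begin
    ℕ→ℚ (Mono G f)                                                ≡⟨ trans (Mono-∑ f) (∑-cong (allFin s) (λ i → Mi-∑ i f)) ⟩
    ∑ (allFin s) (λ i → ∑ ES (λ e → Z i e f))                     ≡⟨ ∑-swap (allFin s) ES (λ i e → Z i e f) ⟩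
    ∑ ES (λ e → ∑ (allFin s) (λ i → Z i e f))                     ≤⟨ ∑-mono ES (λ e → ≤-trans (∑-mono (allFin s) (λ i →
                                                                       *-monoˡ (0≤δ (f (proj₁ e)) i) (δ≤1 (f (proj₂ e)) i)))
                                                                       (≤-reflexive (∑-δ (f (proj₁ e)) (λ _ → 1ℚ)))) ⟩
    ∑ ES (λ _ → 1ℚ)                                               ≡⟨ trans (∑-const ES 1ℚ) (*-identityʳ m) ⟩
    m                                                             ∎)
    where open ≤-Reasoning

  Bi≡ : ∀ {s} (f : Fin n → Fin s) → ℕ→ℚ (Bi G f) ≡ m - ℕ→ℚ (Mono G f)
  Bi≡ f = trans (lem (ℕ→ℚ (Bi G f)) (ℕ→ℚ (Mono G f)))
    (cong (_- ℕ→ℚ (Mono G f)) (trans (sym (ℕ→ℚ-+ (Bi G f) (Mono G f))) (cong ℕ→ℚ (ℕP.m∸n+n≡m (Mono≤m f)))))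
    where lem : ∀ b x → b ≡ (b + x) - x
          lem = solve-∀ ℚ-ring

-- Covariances of the numbers of monochromatic edges

module CountCovariance {n s : ℕ} (G : Graph n) (c : Fin s → ℕ) (comp : ∑ (allFin s) (ℕ→ℚ ∘ c) ≡ ℕ→ℚ n) (1≤n : 1 ℕ.≤ n) where
  open Expectation {n} {s} c comp
  open Moments 1≤n
  open Covariance {n} {s} c comp 1≤n
  open GraphSums G

  cov-∑ : ∀ {A B : Set} (xs : List A) (ys : List B) (X : A → (Fin n → Fin s) → ℚ) (Y : B → (Fin n → Fin s) → ℚ) →
    cov (λ f → ∑ xs (λ a → X a f)) (λ f → ∑ ys (λ b → Y b f)) ≡ ∑ xs (λ a → ∑ ys (λ b → cov (X a) (Y b)))
  cov-∑ xs ys X Y = begin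
    E (λ f → ∑ xs (λ a → X a f) * ∑ ys (λ b → Y b f)) - E (λ f → ∑ xs (λ a → X a f)) * E (λ f → ∑ ys (λ b → Y b f))
      ≡⟨ cong₂ _-_ mixed (cong₂ _*_ (E-∑ xs X) (E-∑ ys Y)) ⟩
    ∑ xs (λ a → ∑ ys (λ b → E (λ f → X a f * Y b f))) - ∑ xs (λ a → E (X a)) * ∑ ys (λ b → E (Y b))
      ≡⟨ cong (λ t → ∑ xs (λ a → ∑ ys (λ b → E (λ f → X a f * Y b f))) - t) (product xs ys (λ a → E (X a)) (λ b → E (Y b))) ⟩
    ∑ xs (λ a → ∑ ys (λ b → E (λ f → X a f * Y b f))) - ∑ xs (λ a → ∑ ys (λ b → E (X a) * E (Y b)))
      ≡⟨ ∑-- xs (λ a → ∑ ys (λ b → E (λ f → X a f * Y b f))) (λ a → ∑ ys (λ b → E (X a) * E (Y b))) ⟨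
    ∑ xs (λ a → ∑ ys (λ b → E (λ f → X a f * Y b f)) - ∑ ys (λ b → E (X a) * E (Y b)))
      ≡⟨ ∑-cong xs (λ a → sym (∑-- ys (λ b → E (λ f → X a f * Y b f)) (λ b → E (X a) * E (Y b)))) ⟩
    ∑ xs (λ a → ∑ ys (λ b → cov (X a) (Y b))) ∎
    where
    open ≡-Reasoning
    product : ∀ {A B : Set} (xs : List A) (ys : List B) (g : A → ℚ) (h : B → ℚ) → ∑ xs g * ∑ ys h ≡ ∑ xs (λ a → ∑ ys (λ b → g a * h b))
    product xs ys g h = trans (sym (∑-*ʳ (∑ ys h) xs g)) (∑-cong xs (λ a → sym (∑-*ˡ (g a) ys h)))
    mixed : E (λ f → ∑ xs (λ a → X a f) * ∑ ys (λ b → Y b f)) ≡ ∑ xs (λ a → ∑ ys (λ b → E (λ f → X a f * Y b f)))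
    mixed = begin
      E (λ f → ∑ xs (λ a → X a f) * ∑ ys (λ b → Y b f))
        ≡⟨ E-cong′ {λ f → ∑ xs (λ a → X a f) * ∑ ys (λ b → Y b f)} (λ f → product xs ys (λ a → X a f) (λ b → Y b f)) ⟩
      E (λ f → ∑ xs (λ a → ∑ ys (λ b → X a f * Y b f)))
        ≡⟨ E-∑ xs (λ a f → ∑ ys (λ b → X a f * Y b f)) ⟩
      ∑ xs (λ a → E (λ f → ∑ ys (λ b → X a f * Y b f)))
        ≡⟨ ∑-cong xs (λ a → E-∑ ys (λ b f → X a f * Y b f)) ⟩
      ∑ xs (λ a → ∑ ys (λ b → E (λ f → X a f * Y b f))) ∎

  M : Fin s → (Fin n → Fin s) → ℚ
  M i f = ℕ→ℚ (Mi G i f)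

  -- Each of the m² ordered pairs of edges costs 8 units of `η`. Each edge costs 6 more: the price 3
  -- of a coincidence times the bound 2 on the coincidences with that edge.
  Error : ℚ
  Error = m * (m * (K₈ * η)) + m * ℕ→ℚ 6

  cov-Mi : ∀ i j → ∣ cov (M i) (M j) - ℕ→ℚ (Σ₂ G) * V i j ∣ ≤ Error
  cov-Mi i j = begin
    ∣ cov (M i) (M j) - ℕ→ℚ (Σ₂ G) * V i j ∣
      ≡⟨ cong ∣_∣ (cong₂ _-_ (trans (cov-cong {M i} {_} {M j} (Mi-∑ i) (Mi-∑ j)) (cov-∑ ES ES (Z i) (Z j)))
           (trans (cong (_* V i j) (sym ∑-incidences)) (trans (sym (∑-*ʳ (V i j) ES (λ e → ∑ ES (incidences e))))
             (∑-cong ES (λ e → sym (∑-*ʳ (V i j) ES (incidences e))))))) ⟩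
    ∣ ∑ ES (λ e → ∑ ES (λ e′ → cov (Z i e) (Z j e′))) - ∑ ES (λ e → ∑ ES (λ e′ → incidences e e′ * V i j)) ∣
      ≡⟨ cong ∣_∣ (trans (sym (∑-- ES (λ e → ∑ ES (λ e′ → cov (Z i e) (Z j e′))) (λ e → ∑ ES (λ e′ → incidences e e′ * V i j))))
           (∑-cong ES (λ e → sym (∑-- ES (λ e′ → cov (Z i e) (Z j e′)) (λ e′ → incidences e e′ * V i j))))) ⟩
    ∣ ∑ ES (λ e → ∑ ES (λ e′ → cov (Z i e) (Z j e′) - incidences e e′ * V i j)) ∣
      ≤⟨ ≤-trans (∣∑∣≤ ES (λ e → ∑ ES (λ e′ → D e e′))) (∑-mono ES (λ e → ∣∑∣≤ ES (D e))) ⟩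
    ∑ ES (λ e → ∑ ES (λ e′ → ∣ D e e′ ∣))
      -- `cov-pair` asks for distinct endpoints, which is known for members of the edge list; the
      -- comparison therefore runs along membership proofs.
      ≤⟨ ∑-mono-∈ ES (λ e∈ → ∑-mono-∈ ES (λ e′∈ → cov-pair i j _ _ (edge-≢ e∈) (edge-≢ e′∈))) ⟩
    ∑ ES (λ e → ∑ ES (λ e′ → K₈ * η + ℕ→ℚ 3 * coincidences e e′))
      ≤⟨ ∑-mono ES (λ e → ≤-trans (≤-reflexive (trans (∑-+ ES (λ _ → K₈ * η) (λ e′ → ℕ→ℚ 3 * coincidences e e′))
             (cong₂ _+_ (∑-const ES (K₈ * η)) (∑-*ˡ (ℕ→ℚ 3) ES (coincidences e)))))
             (+-monoʳ-≤ (m * (K₈ * η)) (*-monoˡ (0≤ℕ 3) (∑-coincidences e)))) ⟩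
    ∑ ES (λ e → m * (K₈ * η) + ℕ→ℚ 6)
      ≡⟨ trans (∑-const ES (m * (K₈ * η) + ℕ→ℚ 6)) (*-distribˡ-+ m (m * (K₈ * η)) (ℕ→ℚ 6)) ⟩
    Error ∎
    where
    open ≤-Reasoning
    D : Fin n × Fin n → Fin n × Fin n → ℚ
    D e e′ = cov (Z i e) (Z j e′) - incidences e e′ * V i j

-- Variance bounds and lower bounds on the means

p+p≤q+q⇒p≤q : ∀ {p q} → p + p ≤ q + q → p ≤ q
p+p≤q+q⇒p≤q {p} {q} h with p ≤? q
... | yes p≤q = p≤q
... | no p≰q = contradiction (≤-<-trans h (+-mono-< (≰⇒> p≰q) (≰⇒> p≰q))) (<-irrefl refl)

∑-constFin : ∀ {s} k → ∑ (allFin s) (λ _ → k) ≡ ℕ→ℚ s * k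
∑-constFin {s} k = trans (∑-const (allFin s) k) (cong (λ l → ℕ→ℚ l * k) (ListP.length-tabulate {n = s} (λ i → i)))

𝟙*≤ : ∀ {P : Set} (d : Dec P) p q → 0ℚ ≤ q → (P → p ≤ q) → 𝟙 ⌊ d ⌋ * p ≤ q
𝟙*≤ (yes h) p q 0≤q k = ≤-trans (≤-reflexive (*-identityˡ p)) (k h)
𝟙*≤ (no _) p q 0≤q k = ≤-trans (≤-reflexive (*-zeroˡ p)) 0≤q

≤*𝟙 : ∀ {P : Set} (d : Dec P) p q → (P → p ≤ q) → (¬ P → p ≤ 0ℚ) → p ≤ q * 𝟙 ⌊ d ⌋
≤*𝟙 (yes h) p q k k′ = ≤-trans (k h) (≤-reflexive (sym (*-identityʳ q)))
≤*𝟙 (no h) p q k k′ = ≤-trans (k′ h) (≤-reflexive (sym (*-zeroʳ q)))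

module VarianceBounds {n s : ℕ} (G : Graph n) (c : Fin s → ℕ) (comp : ∑ (allFin s) (ℕ→ℚ ∘ c) ≡ ℕ→ℚ n) (1≤n : 1 ℕ.≤ n) where
  open Expectation {n} {s} c comp
  open Moments 1≤n
  open Covariance {n} {s} c comp 1≤n
  open GraphSums G
  open CountCovariance {n} {s} G c comp 1≤n

  var : ((Fin n → Fin s) → ℚ) → ℚ
  var X = cov X X

  var≡ : ∀ X → E (λ f → (X f - E X) * (X f - E X)) ≡ var X
  var≡ X = begin
    E (λ f → (X f - E X) * (X f - E X))
      ≡⟨ E-cong′ {λ f → (X f - E X) * (X f - E X)} (λ f → l1 (X f) (E X)) ⟩
    E (λ f → X f * X f - ((E X + E X) * X f - E X * E X))
      ≡⟨ E-- (λ f → X f * X f) (λ f → (E X + E X) * X f - E X * E X) ⟩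
    E (λ f → X f * X f) - E (λ f → (E X + E X) * X f - E X * E X)
      ≡⟨ cong (λ t → E (λ f → X f * X f) - t) (trans (E-- (λ f → (E X + E X) * X f) (λ _ → E X * E X))
           (cong₂ _-_ (E-*ˡ (E X + E X) X) (E-const (E X * E X)))) ⟩
    E (λ f → X f * X f) - ((E X + E X) * E X - E X * E X)
      ≡⟨ l2 (E (λ f → X f * X f)) (E X) ⟩
    var X ∎
    where
    open ≡-Reasoning
    l1 : ∀ a μ → (a - μ) * (a - μ) ≡ a * a - ((μ + μ) * a - μ * μ)
    l1 = solve-∀ ℚ-ring
    l2 : ∀ a μ → a - ((μ + μ) * μ - μ * μ) ≡ a - μ * μ
    l2 = solve-∀ ℚ-ring

  𝔼-var : ∀ X → E (λ f → (ℕ→ℚ (X f) - 𝔼 n s c X) * (ℕ→ℚ (X f) - 𝔼 n s c X)) ≡ var (ℕ→ℚ ∘ X)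
  𝔼-var X = trans (cong (λ μ → E (λ f → (ℕ→ℚ (X f) - μ) * (ℕ→ℚ (X f) - μ))) (𝔼≡E X)) (var≡ (ℕ→ℚ ∘ X))

  0≤𝔼 : ∀ X → 0ℚ ≤ 𝔼 n s c X
  0≤𝔼 X = subst (0ℚ ≤_) (sym (𝔼≡E X)) (0≤E (0≤ℕ ∘ X))

  -- Kept in multiplied form; the division by the squared mean is postponed until that mean is
  -- bounded below by a multiple of m.
  chebyshev : ∀ X ε → 0ℚ ≤ ε →
    Pr n s c (Deviates n s c X ε) * ((ε * 𝔼 n s c X) * (ε * 𝔼 n s c X)) ≤ var (ℕ→ℚ ∘ X)
  chebyshev X ε 0≤ε = begin
    Pr n s c D * (t * t)                        ≡⟨ cong (_* (t * t)) (Pr≡E D) ⟩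
    E (𝟙 ∘ D) * (t * t)                         ≡⟨ E-*ʳ (t * t) (𝟙 ∘ D) ⟨
    E (λ f → 𝟙 (D f) * (t * t))                 ≤⟨ E-mono {λ f → 𝟙 (D f) * (t * t)} {λ f → (ℕ→ℚ (X f) - μ) * (ℕ→ℚ (X f) - μ)} (λ f _ → pointwise f) ⟩
    E (λ f → (ℕ→ℚ (X f) - μ) * (ℕ→ℚ (X f) - μ)) ≡⟨ 𝔼-var X ⟩
    var (ℕ→ℚ ∘ X)                               ∎
    where
    open ≤-Reasoning
    D = Deviates n s c X ε
    μ = 𝔼 n s c X
    t = ε * μ
    0≤t : 0ℚ ≤ t
    0≤t = 0≤* 0≤ε (0≤𝔼 X)
    pointwise : ∀ f → 𝟙 (D f) * (t * t) ≤ (ℕ→ℚ (X f) - μ) * (ℕ→ℚ (X f) - μ)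
    pointwise f = 𝟙*≤ (t <? ∣ ℕ→ℚ (X f) - μ ∣) (t * t) ((ℕ→ℚ (X f) - μ) * (ℕ→ℚ (X f) - μ)) (0≤p² (ℕ→ℚ (X f) - μ))
      (λ h → ≤-trans (*-mono 0≤t (0≤∣p∣ (ℕ→ℚ (X f) - μ)) (<⇒≤ h) (<⇒≤ h)) (≤-reflexive (∣p∣²≡p² (ℕ→ℚ (X f) - μ))))

  var≤Differs : ∀ X → (∀ f → X f ℕ.≤ numEdges G) → var (ℕ→ℚ ∘ X) ≤ (m * m) * Pr n s c (Differs n s c X)
  var≤Differs X X≤m = begin
    var (ℕ→ℚ ∘ X)                               ≡⟨ 𝔼-var X ⟨
    E (λ f → (ℕ→ℚ (X f) - μ) * (ℕ→ℚ (X f) - μ)) ≤⟨ E-mono {λ f → (ℕ→ℚ (X f) - μ) * (ℕ→ℚ (X f) - μ)} {λ f → (m * m) * 𝟙 (D f)} (λ f _ → pointwise f) ⟩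
    E (λ f → (m * m) * 𝟙 (D f))                 ≡⟨ E-*ˡ (m * m) (𝟙 ∘ D) ⟩
    (m * m) * E (𝟙 ∘ D)                         ≡⟨ cong ((m * m) *_) (Pr≡E D) ⟨
    (m * m) * Pr n s c D                        ∎
    where
    open ≤-Reasoning
    D = Differs n s c X
    μ = 𝔼 n s c X
    μ≤m : μ ≤ m
    μ≤m = subst (_≤ m) (sym (𝔼≡E X)) (E≤ {ℕ→ℚ ∘ X} (ℕ→ℚ-mono ∘ X≤m))
    pointwise : ∀ f → (ℕ→ℚ (X f) - μ) * (ℕ→ℚ (X f) - μ) ≤ (m * m) * 𝟙 (D f)
    pointwise f = ≤*𝟙 (0ℚ <? ∣ ℕ→ℚ (X f) - μ ∣) ((ℕ→ℚ (X f) - μ) * (ℕ→ℚ (X f) - μ)) (m * m)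
      (λ _ → ≤-trans (≤-reflexive (sym (∣p∣²≡p² (ℕ→ℚ (X f) - μ)))) (*-mono (0≤∣p∣ (ℕ→ℚ (X f) - μ)) (0≤ℕ (numEdges G)) bound bound))
      (λ h → ≤-trans (≤-reflexive (sym (∣p∣²≡p² (ℕ→ℚ (X f) - μ)))) (*-mono (0≤∣p∣ (ℕ→ℚ (X f) - μ)) ≤-refl (≮⇒≥ h) (≮⇒≥ h)))
      where bound : ∣ ℕ→ℚ (X f) - μ ∣ ≤ m
            bound = ∣x-y∣≤ (0≤ℕ (X f)) (ℕ→ℚ-mono (X≤m f)) (0≤𝔼 X) μ≤m

  Σ₂ℚ : ℚ
  Σ₂ℚ = ℕ→ℚ (Σ₂ G)

  -- The crude bound `V i i ≤ 1` suffices, since this estimate serves the case Σ₂ = o(m²).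
  var-Mi : ∀ i → var (M i) ≤ Σ₂ℚ + Error
  var-Mi i = begin
    var (M i)                                     ≡⟨ lem (var (M i)) (Σ₂ℚ * V i i) ⟩
    Σ₂ℚ * V i i + (var (M i) - Σ₂ℚ * V i i)       ≤⟨ +-mono-≤ (*-monoˡ (0≤ℕ (Σ₂ G)) (≤-trans (p≤∣p∣ (V i i)) (∣V∣≤1 i i)))
                                                       (≤-trans (p≤∣p∣ (var (M i) - Σ₂ℚ * V i i)) (cov-Mi i i)) ⟩
    Σ₂ℚ * 1ℚ + Error                              ≡⟨ cong (_+ Error) (*-identityʳ Σ₂ℚ) ⟩
    Σ₂ℚ + Error                                   ∎
    where open ≤-Reasoning
          lem : ∀ a b → a ≡ b + (a - b)
          lem = solve-∀ ℚ-ring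

  W : ℚ
  W = ∑ (allFin s) (λ i → ∑ (allFin s) (V i))

  MonoError : ℚ
  MonoError = ℕ→ℚ s * (ℕ→ℚ s * Error)

  var-Mono : ∣ var (ℕ→ℚ ∘ Mono G) - Σ₂ℚ * W ∣ ≤ MonoError
  var-Mono = begin
    ∣ var (ℕ→ℚ ∘ Mono G) - Σ₂ℚ * W ∣
      ≡⟨ cong ∣_∣ (cong₂ _-_ (trans (cov-cong {ℕ→ℚ ∘ Mono G} {_} {ℕ→ℚ ∘ Mono G} Mono-∑ Mono-∑) (cov-∑ (allFin s) (allFin s) M M))
           (trans (sym (∑-*ˡ Σ₂ℚ (allFin s) (λ i → ∑ (allFin s) (V i)))) (∑-cong (allFin s) (λ i → sym (∑-*ˡ Σ₂ℚ (allFin s) (V i)))))) ⟩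
    ∣ ∑ (allFin s) (λ i → ∑ (allFin s) (λ j → cov (M i) (M j))) - ∑ (allFin s) (λ i → ∑ (allFin s) (λ j → Σ₂ℚ * V i j)) ∣
      ≡⟨ cong ∣_∣ (trans (sym (∑-- (allFin s) (λ i → ∑ (allFin s) (λ j → cov (M i) (M j))) (λ i → ∑ (allFin s) (λ j → Σ₂ℚ * V i j))))
           (∑-cong (allFin s) (λ i → sym (∑-- (allFin s) (λ j → cov (M i) (M j)) (λ j → Σ₂ℚ * V i j))))) ⟩
    ∣ ∑ (allFin s) (λ i → ∑ (allFin s) (D i)) ∣
      ≤⟨ ≤-trans (∣∑∣≤ (allFin s) (λ i → ∑ (allFin s) (D i))) (∑-mono (allFin s) (λ i → ∣∑∣≤ (allFin s) (D i))) ⟩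
    ∑ (allFin s) (λ i → ∑ (allFin s) (λ j → ∣ D i j ∣))
      ≤⟨ ∑-mono (allFin s) (λ i → ∑-mono (allFin s) (λ j → cov-Mi i j)) ⟩
    ∑ (allFin s) (λ i → ∑ (allFin s) (λ j → Error))
      ≡⟨ trans (∑-cong (allFin s) (λ i → ∑-constFin {s} Error)) (∑-constFin {s} (ℕ→ℚ s * Error)) ⟩
    MonoError ∎
    where
    open ≤-Reasoning
    D : Fin s → Fin s → ℚ
    D i j = cov (M i) (M j) - Σ₂ℚ * V i j

  𝔼-Bi : 𝔼 n s c (Bi G) ≡ m - 𝔼 n s c (Mono G)
  𝔼-Bi = begin
    𝔼 n s c (Bi G)                       ≡⟨ 𝔼≡E (Bi G) ⟩
    E (ℕ→ℚ ∘ Bi G)                       ≡⟨ E-cong′ {ℕ→ℚ ∘ Bi G} Bi≡ ⟩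
    E (λ f → m - ℕ→ℚ (Mono G f))         ≡⟨ E-- (λ _ → m) (ℕ→ℚ ∘ Mono G) ⟩
    E (λ _ → m) - E (ℕ→ℚ ∘ Mono G)       ≡⟨ cong₂ _-_ (E-const m) (sym (𝔼≡E (Mono G))) ⟩
    m - 𝔼 n s c (Mono G)                 ∎
    where open ≡-Reasoning

  -- L and M add up to the constant m, so their deviations from the mean are opposite. Every
  -- variance estimate for M thereby serves L.
  var-Bi : var (ℕ→ℚ ∘ Bi G) ≡ var (ℕ→ℚ ∘ Mono G)
  var-Bi = trans (sym (𝔼-var (Bi G))) (trans (E-cong′ {λ f → (ℕ→ℚ (Bi G f) - 𝔼 n s c (Bi G)) * (ℕ→ℚ (Bi G f) - 𝔼 n s c (Bi G))} pointwise) (𝔼-var (Mono G)))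
    where
    lem : ∀ a b m → (m - a - (m - b)) * (m - a - (m - b)) ≡ (a - b) * (a - b)
    lem = solve-∀ ℚ-ring
    pointwise : ∀ f → (ℕ→ℚ (Bi G f) - 𝔼 n s c (Bi G)) * (ℕ→ℚ (Bi G f) - 𝔼 n s c (Bi G))
                    ≡ (ℕ→ℚ (Mono G f) - 𝔼 n s c (Mono G)) * (ℕ→ℚ (Mono G f) - 𝔼 n s c (Mono G))
    pointwise f = trans (cong₂ (λ a b → (a - b) * (a - b)) (Bi≡ f) 𝔼-Bi) (lem (ℕ→ℚ (Mono G f)) (𝔼 n s c (Mono G)) m)

  E-Mi : ∀ i → E (M i) ≡ ∑ ES (λ e → E (Z i e))
  E-Mi i = trans (E-cong′ {M i} (Mi-∑ i)) (E-∑ ES (Z i))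

  E-Mi-lower : ∀ i → m * (x i * x i - η) ≤ E (M i)
  E-Mi-lower i = begin
    m * (x i * x i - η)                  ≡⟨ ∑-const ES (x i * x i - η) ⟨
    ∑ ES (λ _ → x i * x i - η)           ≤⟨ ∑-mono-∈ ES (λ {e} e∈ → step (E (Z i e)) (x i * x i) (EZ-approx i (edge-≢ e∈))) ⟩
    ∑ ES (λ e → E (Z i e))               ≡⟨ E-Mi i ⟨
    E (M i)                              ∎
    where
    open ≤-Reasoning
    step : ∀ a b → ∣ a - b ∣ ≤ η → b - η ≤ a
    step a b h = ≤-from-diff (p≤q⇒0≤q-p (≤-trans (-p≤∣p∣ (a - b)) h)) (lem a b η)
      where lem : ∀ a b η → a - (b - η) ≡ η - (- (a - b))
            lem = solve-∀ ℚ-ring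

  E-Mi-upper : ∀ i → E (M i) ≤ m * (x i * x i + η)
  E-Mi-upper i = begin
    E (M i)                              ≡⟨ E-Mi i ⟩
    ∑ ES (λ e → E (Z i e))               ≤⟨ ∑-mono-∈ ES (λ {e} e∈ → step (E (Z i e)) (x i * x i) (EZ-approx i (edge-≢ e∈))) ⟩
    ∑ ES (λ _ → x i * x i + η)           ≡⟨ ∑-const ES (x i * x i + η) ⟩
    m * (x i * x i + η)                  ∎
    where
    open ≤-Reasoning
    step : ∀ a b → ∣ a - b ∣ ≤ η → a ≤ b + η
    step a b h = ≤-from-diff (p≤q⇒0≤q-p (≤-trans (p≤∣p∣ (a - b)) h)) (lem a b η)
      where lem : ∀ a b η → b + η - a ≡ η - (a - b)
            lem = solve-∀ ℚ-ring

  E-Mono : E (ℕ→ℚ ∘ Mono G) ≡ ∑ (allFin s) (λ i → E (M i))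
  E-Mono = trans (E-cong′ {ℕ→ℚ ∘ Mono G} Mono-∑) (E-∑ (allFin s) M)

  𝔼-Mi-lower : ∀ i → m * (x i * x i - η) ≤ 𝔼 n s c (Mi G i)
  𝔼-Mi-lower i = subst (m * (x i * x i - η) ≤_) (sym (𝔼≡E (Mi G i))) (E-Mi-lower i)

  𝔼-Mono-lower : ∀ i → m * (x i * x i - η) ≤ 𝔼 n s c (Mono G)
  𝔼-Mono-lower i = ≤-trans (E-Mi-lower i) (≤-trans (term≤∑ i (λ j → E (M j)) (λ j → 0≤E (λ f → 0≤ℕ (Mi G j f))))
    (≤-reflexive (sym (trans (𝔼≡E (Mono G)) E-Mono))))

  ∑x² : ℚ
  ∑x² = ∑ (allFin s) (λ i → x i * x i)

  -- The mean of L is near m (1 - Σ x_k²), and 1 - Σ x_k² = Σ x_k (1 - x_k) ≥ x_i (1 - x_i) ≥ x_i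
  -- x_j because x_i + x_j ≤ 1. The error collects one `η` from each of the s classes.
  𝔼-Bi-lower : ∀ i j → i ≢ j → m * (x i * x j - ℕ→ℚ s * η) ≤ 𝔼 n s c (Bi G)
  𝔼-Bi-lower i j i≢j = begin
    m * (x i * x j - ℕ→ℚ s * η)
      ≤⟨ *-monoˡ (0≤ℕ (numEdges G)) (+-monoˡ-≤ (- (ℕ→ℚ s * η)) gap) ⟩
    m * ((1ℚ - ∑x²) - ℕ→ℚ s * η)
      ≡⟨ lem m ∑x² (ℕ→ℚ s * η) ⟩
    m - m * (∑x² + ℕ→ℚ s * η)
      ≤⟨ +-monoʳ-≤ m (neg-antimono-≤ mono) ⟩
    m - 𝔼 n s c (Mono G)
      ≡⟨ 𝔼-Bi ⟨
    𝔼 n s c (Bi G) ∎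
    where
    open ≤-Reasoning
    lem : ∀ m a b → m * ((1ℚ - a) - b) ≡ m - m * (a + b)
    lem = solve-∀ ℚ-ring
    mono : 𝔼 n s c (Mono G) ≤ m * (∑x² + ℕ→ℚ s * η)
    mono = begin
      𝔼 n s c (Mono G)                                       ≡⟨ trans (𝔼≡E (Mono G)) E-Mono ⟩
      ∑ (allFin s) (λ i → E (M i))                           ≤⟨ ∑-mono (allFin s) E-Mi-upper ⟩
      ∑ (allFin s) (λ i → m * (x i * x i + η))               ≡⟨ ∑-*ˡ m (allFin s) (λ i → x i * x i + η) ⟩
      m * ∑ (allFin s) (λ i → x i * x i + η)                 ≡⟨ cong (m *_) (trans (∑-+ (allFin s) (λ i → x i * x i) (λ _ → η)) (cong (∑x² +_) (∑-constFin {s} η))) ⟩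
      m * (∑x² + ℕ→ℚ s * η)                                  ∎
    x+x≤1 : x i + x j ≤ 1ℚ
    x+x≤1 = begin
      x i + x j                                              ≡⟨ cong₂ _+_ (∑-δ i x) (∑-δ j x) ⟨
      ∑ (allFin s) (λ k → δ i k * x k) + ∑ (allFin s) (λ k → δ j k * x k) ≡⟨ ∑-+ (allFin s) (λ k → δ i k * x k) (λ k → δ j k * x k) ⟨
      ∑ (allFin s) (λ k → δ i k * x k + δ j k * x k)         ≤⟨ ∑-mono (allFin s) (λ k → ≤-trans (≤-reflexive (sym (*-distribʳ-+ (x k) (δ i k) (δ j k))))
                                                                  (≤-trans (*-monoʳ (0≤x k) (δ+δ≤1 k)) (≤-reflexive (*-identityˡ (x k))))) ⟩
      ∑ (allFin s) x                                         ≡⟨ ∑x ⟩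
      1ℚ                                                     ∎
      where δ+δ≤1 : ∀ k → δ i k + δ j k ≤ 1ℚ
            δ+δ≤1 k with i FinP.≟ k
            ... | yes i≡k = ≤-reflexive (cong (1ℚ +_) (δ-≢ (λ j≡k → i≢j (trans i≡k (sym j≡k)))))
            ... | no _ = ≤-trans (≤-reflexive (+-identityˡ (δ j k))) (δ≤1 j k)
    gap : x i * x j ≤ 1ℚ - ∑x²
    gap = begin
      x i * x j                                              ≤⟨ *-monoˡ (0≤x i) (≤-from-diff (p≤q⇒0≤q-p x+x≤1) (l3 (x i) (x j))) ⟩
      x i * (1ℚ - x i)                                       ≤⟨ term≤∑ i (λ k → x k * (1ℚ - x k)) (λ k → 0≤* (0≤x k) (p≤q⇒0≤q-p (x≤1 k))) ⟩
      ∑ (allFin s) (λ k → x k * (1ℚ - x k))                  ≡⟨ ∑-cong (allFin s) (λ k → l4 (x k)) ⟩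
      ∑ (allFin s) (λ k → x k - x k * x k)                   ≡⟨ ∑-- (allFin s) x (λ k → x k * x k) ⟩
      ∑ (allFin s) x - ∑x²                                   ≡⟨ cong (_- ∑x²) ∑x ⟩
      1ℚ - ∑x²                                               ∎
      where l3 : ∀ a b → 1ℚ - a - b ≡ 1ℚ - (a + b)
            l3 = solve-∀ ℚ-ring
            l4 : ∀ a → a * (1ℚ - a) ≡ a - a * a
            l4 = solve-∀ ℚ-ring

  -- The sum of the entries of `V` and the distance from the uniform vector

  ∑∑ : (Fin s → Fin s → ℚ) → ℚ
  ∑∑ g = ∑ (allFin s) (λ i → ∑ (allFin s) (g i))

  ∑∑-product : ∀ (g h : Fin s → ℚ) → ∑∑ (λ i j → g i * h j) ≡ ∑ (allFin s) g * ∑ (allFin s) h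
  ∑∑-product g h = trans (∑-cong (allFin s) (λ i → ∑-*ˡ (g i) (allFin s) h)) (∑-*ʳ (∑ (allFin s) h) (allFin s) g)

  ∑∑-+ : ∀ g h → ∑∑ (λ i j → g i j + h i j) ≡ ∑∑ g + ∑∑ h
  ∑∑-+ g h = trans (∑-cong (allFin s) (λ i → ∑-+ (allFin s) (g i) (h i))) (∑-+ (allFin s) (λ i → ∑ (allFin s) (g i)) (λ i → ∑ (allFin s) (h i)))

  ∑∑-- : ∀ g h → ∑∑ (λ i j → g i j - h i j) ≡ ∑∑ g - ∑∑ h
  ∑∑-- g h = trans (∑-cong (allFin s) (λ i → ∑-- (allFin s) (g i) (h i))) (∑-- (allFin s) (λ i → ∑ (allFin s) (g i)) (λ i → ∑ (allFin s) (h i)))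

  -- `W` is Σ x³ - (Σ x²)². Multiplying the cubic sum by Σ x = 1, once on either side, makes every
  -- term a double sum of degree four, and the summand becomes a weighted square. Doubling gives the
  -- symmetric form without a factor ½.
  W+W : W + W ≡ ∑∑ (λ i j → (x i * x j) * ((x i - x j) * (x i - x j)))
  W+W = begin
    W + W
      ≡⟨ cong₂ _+_ W≡ W≡ ⟩
    (S₃ - ∑x² * ∑x²) + (S₃ - ∑x² * ∑x²)
      ≡⟨ l1 S₃ ∑x² ⟩
    (S₃ * 1ℚ + 1ℚ * S₃) - (∑x² * ∑x² + ∑x² * ∑x²)
      ≡⟨ cong (λ t → (S₃ * t + t * S₃) - (∑x² * ∑x² + ∑x² * ∑x²)) ∑x ⟨
    (S₃ * ∑ (allFin s) x + ∑ (allFin s) x * S₃) - (∑x² * ∑x² + ∑x² * ∑x²)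
      ≡⟨ cong₂ _-_ (trans (∑∑-+ (λ i j → cube i * x j) (λ i j → x i * cube j)) (cong₂ _+_ (∑∑-product cube x) (∑∑-product x cube)))
           (trans (∑∑-+ (λ i j → square i * square j) (λ i j → square i * square j)) (cong₂ _+_ (∑∑-product square square) (∑∑-product square square))) ⟨
    ∑∑ (λ i j → cube i * x j + x i * cube j) - ∑∑ (λ i j → square i * square j + square i * square j)
      ≡⟨ ∑∑-- (λ i j → cube i * x j + x i * cube j) (λ i j → square i * square j + square i * square j) ⟨
    ∑∑ (λ i j → (cube i * x j + x i * cube j) - (square i * square j + square i * square j))
      ≡⟨ ∑-cong (allFin s) (λ i → ∑-cong (allFin s) (λ j → l2 (x i) (x j))) ⟩
    ∑∑ (λ i j → (x i * x j) * ((x i - x j) * (x i - x j))) ∎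
    where
    open ≡-Reasoning
    square cube : Fin s → ℚ
    square i = x i * x i
    cube i = x i * x i * x i
    S₃ = ∑ (allFin s) cube
    l1 : ∀ a b → (a - b * b) + (a - b * b) ≡ (a * 1ℚ + 1ℚ * a) - (b * b + b * b)
    l1 = solve-∀ ℚ-ring
    l2 : ∀ a b → (a * a * a * b + a * (b * b * b)) - ((a * a) * (b * b) + (a * a) * (b * b)) ≡ (a * b) * ((a - b) * (a - b))
    l2 = solve-∀ ℚ-ring
    W≡ : W ≡ S₃ - ∑x² * ∑x²
    W≡ = trans (∑∑-- (λ i j → δ i j * cube i) (λ i j → square i * square j))
      (cong₂ _-_ (∑-cong (allFin s) (λ i → ∑-δ i (λ _ → cube i))) (∑∑-product square square))

  dist : ℚ
  dist = distSq n s c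

  0≤dist : 0ℚ ≤ dist
  0≤dist = subst (0ℚ ≤_) (sym (foldr-∑ (λ i → (ratio (c i) n - ratio 1 s) * (ratio (c i) n - ratio 1 s)) (allFin s)))
    (0≤∑ (allFin s) (λ i → 0≤p² (ratio (c i) n - ratio 1 s)))

  module _ (1≤s : 1 ℕ.≤ s) where
    -- Expanding with Σ x = 1 gives Σ (x_i - 1/s)² = Σ x_i² - 1/s; the factor s clears the fraction.
    s·dist : ℕ→ℚ s * dist ≡ ℕ→ℚ s * ∑x² - 1ℚ
    s·dist = begin
      ℕ→ℚ s * dist
        ≡⟨ cong (ℕ→ℚ s *_) (foldr-∑ (λ i → (ratio (c i) n - t) * (ratio (c i) n - t)) (allFin s)) ⟩
      ℕ→ℚ s * ∑ (allFin s) (λ i → (ratio (c i) n - t) * (ratio (c i) n - t))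
        ≡⟨ cong (ℕ→ℚ s *_) (∑-cong (allFin s) (λ i → trans (cong (λ y → (y - t) * (y - t)) (ratio≡ (c i) n 1≤n)) (l1 (x i) t))) ⟩
      ℕ→ℚ s * ∑ (allFin s) (λ i → x i * x i - ((t + t) * x i - t * t))
        ≡⟨ cong (ℕ→ℚ s *_) (trans (∑-- (allFin s) (λ i → x i * x i) (λ i → (t + t) * x i - t * t))
             (cong (λ y → ∑x² - y) (trans (∑-- (allFin s) (λ i → (t + t) * x i) (λ _ → t * t))
               (cong₂ _-_ (trans (∑-*ˡ (t + t) (allFin s) x) (cong ((t + t) *_) ∑x)) (∑-constFin {s} (t * t)))))) ⟩
      ℕ→ℚ s * (∑x² - ((t + t) * 1ℚ - ℕ→ℚ s * (t * t)))
        ≡⟨ l2 (ℕ→ℚ s) ∑x² t ⟩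
      ℕ→ℚ s * ∑x² - (t * ℕ→ℚ s + t * ℕ→ℚ s - (t * ℕ→ℚ s) * (t * ℕ→ℚ s))
        ≡⟨ cong (λ y → ℕ→ℚ s * ∑x² - (y + y - y * y)) (ratio-* 1 s 1≤s) ⟩
      ℕ→ℚ s * ∑x² - (1ℚ + 1ℚ - 1ℚ * 1ℚ) ∎
      where
      open ≡-Reasoning
      t = ratio 1 s
      l1 : ∀ a t → (a - t) * (a - t) ≡ a * a - ((t + t) * a - t * t)
      l1 = solve-∀ ℚ-ring
      l2 : ∀ s q t → s * (q - ((t + t) * 1ℚ - s * (t * t))) ≡ s * q - (t * s + t * s - (t * s) * (t * s))
      l2 = solve-∀ ℚ-ring

    -- Lagrange's identity: with Σ x = 1 the squared differences add up to 2 (s Σ x² - 1), which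
    -- ties them to the distance.
    ∑∑-gaps : ∑∑ (λ i j → (x i - x j) * (x i - x j)) ≡ ℕ→ℚ s * dist + ℕ→ℚ s * dist
    ∑∑-gaps = begin
      ∑∑ (λ i j → (x i - x j) * (x i - x j))
        ≡⟨ ∑-cong (allFin s) (λ i → ∑-cong (allFin s) (λ j → l1 (x i) (x j))) ⟩
      ∑∑ (λ i j → (square i * one j + one i * square j) - (x i * x j + x i * x j))
        ≡⟨ ∑∑-- (λ i j → square i * one j + one i * square j) (λ i j → x i * x j + x i * x j) ⟩
      ∑∑ (λ i j → square i * one j + one i * square j) - ∑∑ (λ i j → x i * x j + x i * x j)
        ≡⟨ cong₂ _-_ (trans (∑∑-+ (λ i j → square i * one j) (λ i j → one i * square j)) (cong₂ _+_ (∑∑-product square one) (∑∑-product one square)))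
             (trans (∑∑-+ (λ i j → x i * x j) (λ i j → x i * x j)) (cong₂ _+_ (∑∑-product x x) (∑∑-product x x))) ⟩
      (∑x² * ∑ (allFin s) one + ∑ (allFin s) one * ∑x²) - (∑ (allFin s) x * ∑ (allFin s) x + ∑ (allFin s) x * ∑ (allFin s) x)
        ≡⟨ cong₂ (λ k y → (∑x² * k + k * ∑x²) - (y * y + y * y)) (∑-constFin {s} 1ℚ) ∑x ⟩
      (∑x² * (ℕ→ℚ s * 1ℚ) + (ℕ→ℚ s * 1ℚ) * ∑x²) - (1ℚ * 1ℚ + 1ℚ * 1ℚ)
        ≡⟨ l2 (ℕ→ℚ s) ∑x² ⟩
      (ℕ→ℚ s * ∑x² - 1ℚ) + (ℕ→ℚ s * ∑x² - 1ℚ)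
        ≡⟨ cong₂ _+_ s·dist s·dist ⟨
      ℕ→ℚ s * dist + ℕ→ℚ s * dist ∎
      where
      open ≡-Reasoning
      square one : Fin s → ℚ
      square i = x i * x i
      one _ = 1ℚ
      l1 : ∀ a b → (a - b) * (a - b) ≡ (a * a * 1ℚ + 1ℚ * (b * b)) - (a * b + a * b)
      l1 = solve-∀ ℚ-ring
      l2 : ∀ s q → (q * (s * 1ℚ) + (s * 1ℚ) * q) - (1ℚ * 1ℚ + 1ℚ * 1ℚ) ≡ (s * q - 1ℚ) + (s * q - 1ℚ)
      l2 = solve-∀ ℚ-ring

    -- The double sums in `W+W` and `∑∑-gaps` differ only by the weights `x i * x j`. These are at
    -- most 1, as used here, and at least κ² in `W-lower`.
    W-upper : W ≤ ℕ→ℚ s * dist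
    W-upper = p+p≤q+q⇒p≤q (subst₂ _≤_ (sym W+W) ∑∑-gaps (∑-mono (allFin s) (λ i → ∑-mono (allFin s) (λ j →
      ≤-trans (*-monoʳ (0≤p² (x i - x j)) (*≤1 (0≤x i) (x≤1 i) (x≤1 j))) (≤-reflexive (*-identityˡ ((x i - x j) * (x i - x j))))))))

    W-lower : ∀ κ → 0ℚ ≤ κ → (∀ i → κ ≤ x i) → (κ * κ) * (ℕ→ℚ s * dist) ≤ W
    W-lower κ 0≤κ κ≤x = p+p≤q+q⇒p≤q (begin
      (κ * κ) * (ℕ→ℚ s * dist) + (κ * κ) * (ℕ→ℚ s * dist)
        ≡⟨ *-distribˡ-+ (κ * κ) (ℕ→ℚ s * dist) (ℕ→ℚ s * dist) ⟨
      (κ * κ) * (ℕ→ℚ s * dist + ℕ→ℚ s * dist)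
        ≡⟨ cong ((κ * κ) *_) ∑∑-gaps ⟨
      (κ * κ) * ∑∑ (λ i j → (x i - x j) * (x i - x j))
        ≡⟨ trans (sym (∑-*ˡ (κ * κ) (allFin s) (λ i → ∑ (allFin s) (λ j → (x i - x j) * (x i - x j)))))
             (∑-cong (allFin s) (λ i → sym (∑-*ˡ (κ * κ) (allFin s) (λ j → (x i - x j) * (x i - x j))))) ⟩
      ∑∑ (λ i j → (κ * κ) * ((x i - x j) * (x i - x j)))
        ≤⟨ ∑-mono (allFin s) (λ i → ∑-mono (allFin s) (λ j → *-monoʳ (0≤p² (x i - x j)) (*-mono 0≤κ (0≤x j) (κ≤x i) (κ≤x j)))) ⟩
      ∑∑ (λ i j → (x i * x j) * ((x i - x j) * (x i - x j)))
        ≡⟨ W+W ⟨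
      W + W ∎)
      where open ≤-Reasoning

-- Asymptotics

-- The denominator is at least 1, so a nonnegative rational lies below its numerator.
p≤ℕ : ∀ p → ∃ λ a → p ≤ ℕ→ℚ a
p≤ℕ p@(mkℚ ℤ.+0 d _) = 0 , ≤-reflexive (↥p≡0⇒p≡0 p refl)
p≤ℕ p@(mkℚ ℤ.+[1+ a ] d _) = suc a , ≤-trans (≤-reflexive (sym (*-identityʳ p)))
  (≤-trans (*-monoˡ (nonNegative⁻¹ p) (ℕ→ℚ-mono {1} {suc d} (ℕ.s≤s ℕ.z≤n)))
    (≤-reflexive (trans (cong (_* ℕ→ℚ (suc d)) (sym (↥p/↧p≡p p))) (ratio-* (suc a) (suc d) (ℕ.s≤s ℕ.z≤n)))))
p≤ℕ p@(mkℚ ℤ.-[1+ a ] d _) = 0 , <⇒≤ (negative⁻¹ p)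

inverse : ∀ p → 0ℚ < p → ∃ λ q → (0ℚ < q) × (p * q ≡ 1ℚ)
inverse p h = q , positive⁻¹ q {{1/pos⇒pos p {{positive h}}}} , *-inverseʳ p {{pos⇒nonZero p {{positive h}}}}
  where q = 1/_ p {{pos⇒nonZero p {{positive h}}}}

-- The threshold is the product of a natural number above `k` and one above the inverse of `ν`.
archimedean : ∀ k ν → 0ℚ < ν → ∃ λ N → ∀ n → N ℕ.≤ n → k ≤ ν * ℕ→ℚ n
archimedean k ν 0<ν with inverse ν 0<ν | p≤ℕ k
... | q , _ , νq≡1 | a , k≤a with p≤ℕ q
...   | b , q≤b = b ℕ.* a , λ n N≤n → begin
  k                             ≤⟨ k≤a ⟩
  ℕ→ℚ a                         ≡⟨ *-identityˡ (ℕ→ℚ a) ⟨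
  1ℚ * ℕ→ℚ a                    ≡⟨ cong (_* ℕ→ℚ a) νq≡1 ⟨
  ν * q * ℕ→ℚ a                 ≤⟨ *-monoʳ (0≤ℕ a) (*-monoˡ (<⇒≤ 0<ν) q≤b) ⟩
  ν * ℕ→ℚ b * ℕ→ℚ a             ≡⟨ *-assoc ν (ℕ→ℚ b) (ℕ→ℚ a) ⟩
  ν * (ℕ→ℚ b * ℕ→ℚ a)           ≡⟨ cong (ν *_) (ℕ→ℚ-* b a) ⟨
  ν * ℕ→ℚ (b ℕ.* a)             ≤⟨ *-monoˡ (<⇒≤ 0<ν) (ℕ→ℚ-mono N≤n) ⟩
  ν * ℕ→ℚ n                     ∎
  where open ≤-Reasoning

0<½ : 0ℚ < ½
0<½ = toWitness {a? = 0ℚ <? ½} tt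

halves : ∀ p → ½ * p + ½ * p ≡ p
halves p = trans (sym (*-distribʳ-+ p ½ ½)) (*-identityˡ p)

mapᴱ : ∀ {P Q : ℕ → Set} → (∀ {n} → P n → Q n) → Eventually P → Eventually Q
mapᴱ h (N , p) = N , λ n N≤n → h (p n N≤n)

_∩ᴱ_ : ∀ {P Q : ℕ → Set} → Eventually P → Eventually Q → Eventually (λ n → P n × Q n)
(N , p) ∩ᴱ (N′ , q) = N ℕ.⊔ N′ , λ n h → p n (ℕP.m⊔n≤o⇒m≤o N N′ h) , q n (ℕP.m⊔n≤o⇒n≤o N N′ h)

infixr 4 _∩ᴱ_

fromᴱ : ∀ N → Eventually (N ℕ.≤_)
fromᴱ N = N , λ n h → h

module Asymptotics {s : ℕ} (2≤s : 2 ℕ.≤ s) (G : (n : ℕ) → Graph n) (c : ℕ → Fin s → ℕ)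
  (isComposition : ∀ n → s ℕ.≤ n → IsComposition n s (c n))
  (κ : ℚ) (0<κ : 0ℚ < κ) (large-classes : Eventually (λ n → ∀ i → κ * ℕ→ℚ n ≤ ℕ→ℚ (c n i)))
  (edges→∞ : ∀ K → Eventually (λ n → K ℕ.≤ numEdges (G n))) where

  comp : ∀ n → s ℕ.≤ n → ∑ (allFin s) (ℕ→ℚ ∘ c n) ≡ ℕ→ℚ n
  comp n p = trans (sym (ℕ→ℚ-sum (c n) (allFin s))) (cong ℕ→ℚ (proj₂ (isComposition n p)))

  1≤s : 1 ℕ.≤ s
  1≤s = ℕP.≤-trans (ℕ.s≤s ℕ.z≤n) 2≤s

  1≤n : ∀ n → s ℕ.≤ n → 1 ℕ.≤ n
  1≤n n p = ℕP.≤-trans 1≤s p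

  0<s : 0ℚ < ℕ→ℚ s
  0<s = 0<ℕ 1≤s

  -- Compositions are given for `s ≤ n`, so every estimate at a fixed n carries a proof of this
  -- inequality; asymptotically it is one more eventual condition.
  module At (n : ℕ) (p : s ℕ.≤ n) where
    open Expectation.Moments {n} {s} (c n) (comp n p) (1≤n n p) public using (x; η; 0≤η; 0≤x)
    open CountCovariance {n} {s} (G n) (c n) (comp n p) (1≤n n p) public using (Error; M)
    open Covariance {n} {s} (c n) (comp n p) (1≤n n p) public using (V; ∣V∣≤1)
    open VarianceBounds {n} {s} (G n) (c n) (comp n p) (1≤n n p) public

    κ≤x : (∀ i → κ * ℕ→ℚ n ≤ ℕ→ℚ (c n i)) → ∀ i → κ ≤ x i
    κ≤x h i = begin
      κ                          ≡⟨ *-identityʳ κ ⟨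
      κ * 1ℚ                     ≡⟨ cong (κ *_) (ratio-* 1 n (1≤n n p)) ⟨
      κ * (η * ℕ→ℚ n)            ≡⟨ lem κ η (ℕ→ℚ n) ⟩
      η * (κ * ℕ→ℚ n)            ≤⟨ *-monoˡ 0≤η (h i) ⟩
      x i                        ∎
      where open ≤-Reasoning
            lem : ∀ a b c → a * (b * c) ≡ b * (a * c)
            lem = solve-∀ ℚ-ring

  m : ℕ → ℚ
  m n = ℕ→ℚ (numEdges (G n))

  m² : ℕ → ℚ
  m² n = m n * m n

  0≤m² : ∀ n → 0ℚ ≤ m² n
  0≤m² n = 0≤p² (m n)

  -- A one-sided o(m²): only upper bounds on variances and errors are compared with m².
  Small : (ℕ → ℚ) → Set
  Small A = ∀ ν → 0ℚ < ν → Eventually (λ n → A n ≤ ν * m² n)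

  Small-mono : ∀ {A B} → Eventually (λ n → A n ≤ B n) → Small B → Small A
  Small-mono A≤B sB ν 0<ν = mapᴱ (λ (h , k) → ≤-trans h k) (A≤B ∩ᴱ sB ν 0<ν)

  Small-+ : ∀ {A B} → Small A → Small B → Small (λ n → A n + B n)
  Small-+ sA sB ν 0<ν = mapᴱ (λ {n} (h , k) → ≤-trans (+-mono-≤ h k)
      (≤-reflexive (trans (sym (*-distribʳ-+ (m² n) (½ * ν) (½ * ν))) (cong (_* m² n) (halves ν)))))
    (sA (½ * ν) (0<* 0<½ 0<ν) ∩ᴱ sB (½ * ν) (0<* 0<½ 0<ν))

  Small-* : ∀ {A} k → 0ℚ < k → Small A → Small (λ n → k * A n)
  Small-* {A} k 0<k sA ν 0<ν = let (q , 0<q , kq≡1) = inverse k 0<k in mapᴱ (λ {n} h → ≤-trans (*-monoˡ (<⇒≤ 0<k) h)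
        (≤-reflexive (trans (lem k q ν (m² n)) (trans (cong (_* (ν * m² n)) kq≡1) (*-identityˡ (ν * m² n))))))
        (sA (q * ν) (0<* 0<q 0<ν))
    where lem : ∀ k q ν t → k * (q * ν * t) ≡ k * q * (ν * t)
          lem = solve-∀ ℚ-ring

  eventually-m : ∀ k ν → 0ℚ < ν → Eventually (λ n → k ≤ ν * m n)
  eventually-m k ν 0<ν = let (N , h) = archimedean k ν 0<ν in mapᴱ (λ {n} → h (numEdges (G n))) (edges→∞ N)

  eventually-η : ∀ k ν → 0ℚ < ν → Eventually (λ n → k * ratio 1 n ≤ ν)
  eventually-η k ν 0<ν = mapᴱ (λ {n} (h , 1≤n) → ≤-trans (*-monoʳ (0≤ratio 1 n) h)
      (≤-reflexive (trans (*-assoc ν (ℕ→ℚ n) (ratio 1 n))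
        (trans (cong (ν *_) (trans (*-comm (ℕ→ℚ n) (ratio 1 n)) (ratio-* 1 n 1≤n))) (*-identityʳ ν)))))
    (archimedean k ν 0<ν ∩ᴱ fromᴱ 1)

  -- The `Error` of a fixed n, written without the proof of `s ≤ n` so that it is a sequence defined
  -- for every n.
  error : ℕ → ℚ
  error n = m n * (m n * (ℕ→ℚ 8 * ratio 1 n)) + m n * ℕ→ℚ 6

  -- The first summand is o(m²) because 1/n tends to 0, the second because m tends to infinity.
  Small-error : Small error
  Small-error = Small-+ {λ n → m n * (m n * (ℕ→ℚ 8 * ratio 1 n))} {λ n → m n * ℕ→ℚ 6}
    (λ ν 0<ν → mapᴱ (λ {n} h → ≤-trans (*-monoˡ (0≤ℕ (numEdges (G n))) (*-monoˡ (0≤ℕ (numEdges (G n))) h)) (≤-reflexive (l1 (m n) ν)))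
      (eventually-η (ℕ→ℚ 8) ν 0<ν))
    (λ ν 0<ν → mapᴱ (λ {n} h → ≤-trans (*-monoˡ (0≤ℕ (numEdges (G n))) h) (≤-reflexive (l2 (m n) ν)))
      (eventually-m (ℕ→ℚ 6) ν 0<ν))
    where
    l1 : ∀ m ν → m * (m * ν) ≡ ν * (m * m)
    l1 = solve-∀ ℚ-ring
    l2 : ∀ m ν → m * (ν * m) ≡ ν * (m * m)
    l2 = solve-∀ ℚ-ring

  Σ₂ℚ : ℕ → ℚ
  Σ₂ℚ n = ℕ→ℚ (Σ₂ (G n))

  ζSq-* : ∀ n → 1 ℕ.≤ numEdges (G n) → ζSq (G n) * m² n ≡ Σ₂ℚ n
  ζSq-* n h = trans (cong (ζSq (G n) *_) (sym (ℕ→ℚ-* (numEdges (G n)) (numEdges (G n)))))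
    (ratio-* (Σ₂ (G n)) (numEdges (G n) ℕ.* numEdges (G n)) (ℕP.*-mono-≤ h h))

  Chebyshev : ((n : ℕ) → (Fin n → Fin s) → ℕ) → (ℕ → ℚ) → Set
  Chebyshev X v = Eventually (λ n → ∀ ε → 0ℚ ≤ ε →
    Pr n s (c n) (Deviates n s (c n) (X n) ε) * ((ε * 𝔼 n s (c n) (X n)) * (ε * 𝔼 n s (c n) (X n))) ≤ v n)

  concentration : ∀ (X : (n : ℕ) → (Fin n → Fin s) → ℕ) β v → 0ℚ < β →
    Eventually (λ n → β * m n ≤ 𝔼 n s (c n) (X n)) → Chebyshev X v → Small v → RatioToOneInProb s c X
  concentration X β v 0<β mean cheb small ε δ 0<ε 0<δ =
    mapᴱ (λ {n} (1≤m , βm≤𝔼 , ch , v≤) → bound n 1≤m βm≤𝔼 (ch ε (<⇒≤ 0<ε)) v≤) (edges→∞ 1 ∩ᴱ mean ∩ᴱ cheb ∩ᴱ small ν 0<ν)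
    where
    lem : ∀ δ ε β t → (δ * ((ε * β) * (ε * β))) * (t * t) ≡ δ * ((ε * (β * t)) * (ε * (β * t)))
    lem = solve-∀ ℚ-ring
    -- At the variance bound δ(εβ)² m² Chebyshev's inequality would give only Pr ≤ δ. Choosing `ν`
    -- strictly below δ(εβ)² yields the strict inequality.
    dense = <-dense (0<* 0<δ (0<* (0<* 0<ε 0<β) (0<* 0<ε 0<β)))
    ν = proj₁ dense
    0<ν = proj₁ (proj₂ dense)
    ν<B = proj₂ (proj₂ dense)
    bound : ∀ n → 1 ℕ.≤ numEdges (G n) → β * m n ≤ 𝔼 n s (c n) (X n) →
      Pr n s (c n) (Deviates n s (c n) (X n) ε) * ((ε * 𝔼 n s (c n) (X n)) * (ε * 𝔼 n s (c n) (X n))) ≤ v n →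
      v n ≤ ν * m² n → Pr n s (c n) (Deviates n s (c n) (X n) ε) < δ
    bound n 1≤m βm≤𝔼 ch v≤ = ≰⇒> λ δ≤Pr → <-irrefl refl (begin-strict
      ν * m² n
        <⟨ *-monoˡ-<-pos (m² n) {{positive (0<* (0<ℕ 1≤m) (0<ℕ 1≤m))}} ν<B ⟩
      (δ * ((ε * β) * (ε * β))) * m² n
        ≡⟨ lem δ ε β (m n) ⟩
      δ * ((ε * (β * m n)) * (ε * (β * m n)))
        ≤⟨ *-mono (<⇒≤ 0<δ) (0≤p² (ε * 𝔼 n s (c n) (X n))) δ≤Pr (*-mono 0≤εβm (≤-trans 0≤εβm εβm≤) εβm≤ εβm≤) ⟩
      Pr n s (c n) (Deviates n s (c n) (X n) ε) * ((ε * 𝔼 n s (c n) (X n)) * (ε * 𝔼 n s (c n) (X n)))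
        ≤⟨ ch ⟩
      v n
        ≤⟨ v≤ ⟩
      ν * m² n ∎)
      where
      open ≤-Reasoning
      0≤εβm : 0ℚ ≤ ε * (β * m n)
      0≤εβm = 0≤* (<⇒≤ 0<ε) (0≤* (<⇒≤ 0<β) (0≤ℕ (numEdges (G n))))
      εβm≤ : ε * (β * m n) ≤ ε * 𝔼 n s (c n) (X n)
      εβm≤ = *-monoˡ (<⇒≤ 0<ε) βm≤𝔼

  -- The means divided by m are at least κ² up to O(1/n); half of κ² is given up to absorb this
  -- correction.
  β : ℚ
  β = ½ * (κ * κ)

  0<κ² : 0ℚ < κ * κ
  0<κ² = 0<* 0<κ 0<κ

  0<β : 0ℚ < β
  0<β = 0<* 0<½ 0<κ²

  β-bound : ∀ {p q} → κ * κ ≤ p → q ≤ β → β ≤ p - q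
  β-bound {p} {q} h k = ≤-trans (≤-reflexive (trans (lem β) (cong (_- β) (halves (κ * κ))))) (+-mono-≤ h (neg-antimono-≤ k))
    where lem : ∀ b → b ≡ (b + b) - b
          lem = solve-∀ ℚ-ring

  lower-bound : ∀ n (p : s ℕ.≤ n) i j ξ → (∀ i → κ * ℕ→ℚ n ≤ ℕ→ℚ (c n i)) → ξ ≤ β →
    β * m n ≤ m n * (At.x n p i * At.x n p j - ξ)
  lower-bound n p i j ξ hκ hξ = subst (_≤ m n * (x i * x j - ξ)) (*-comm (m n) β) (*-monoˡ (0≤ℕ (numEdges (G n)))
      (β-bound {x i * x j} {ξ} (*-mono {κ} {κ} {x i} {x j} (<⇒≤ 0<κ) (0≤x j) (κ≤x hκ i) (κ≤x hκ j)) hξ))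
    where open At n p

  mean-Mi : Eventually (λ n → ∀ i → (β * m n ≤ 𝔼 n s (c n) (Mi (G n) i)) × (β * m n ≤ 𝔼 n s (c n) (Mono (G n))))
  mean-Mi = mapᴱ (λ {n} (p , hκ , hη) → bound n p hκ (subst (_≤ β) (*-identityˡ (ratio 1 n)) hη))
    (fromᴱ s ∩ᴱ large-classes ∩ᴱ eventually-η 1ℚ β 0<β)
    where
    bound : ∀ n (p : s ℕ.≤ n) → (∀ i → κ * ℕ→ℚ n ≤ ℕ→ℚ (c n i)) → ratio 1 n ≤ β →
      ∀ i → (β * m n ≤ 𝔼 n s (c n) (Mi (G n) i)) × (β * m n ≤ 𝔼 n s (c n) (Mono (G n)))
    bound n p hκ hη i = ≤-trans below (At.𝔼-Mi-lower n p i) , ≤-trans below (At.𝔼-Mono-lower n p i)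
      where below = lower-bound n p i i (ratio 1 n) hκ hη

  mean-Bi : Eventually (λ n → ∀ i j → i ≢ j → β * m n ≤ 𝔼 n s (c n) (Bi (G n)))
  mean-Bi = mapᴱ (λ {n} (p , hκ , hη) i j i≢j → ≤-trans (lower-bound n p i j (ℕ→ℚ s * ratio 1 n) hκ hη) (At.𝔼-Bi-lower n p i j i≢j))
    (fromᴱ s ∩ᴱ large-classes ∩ᴱ eventually-η (ℕ→ℚ s) β 0<β)

  distinct-pair : ∃ λ (i : Fin s) → ∃ λ j → i ≢ j
  distinct-pair = go 2≤s
    where go : ∀ {s} → 2 ℕ.≤ s → ∃ λ (i : Fin s) → ∃ λ j → i ≢ j
          go (ℕ.s≤s (ℕ.s≤s _)) = Fin.zero , Fin.suc Fin.zero , λ ()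

  mean-Mono : Eventually (λ n → β * m n ≤ 𝔼 n s (c n) (Mono (G n)))
  mean-Mono = mapᴱ (λ h → proj₂ (h (proj₁ distinct-pair))) mean-Mi

  monoError : ℕ → ℚ
  monoError n = ℕ→ℚ s * (ℕ→ℚ s * error n)

  Small-monoError : Small monoError
  Small-monoError = Small-* (ℕ→ℚ s) 0<s (Small-* (ℕ→ℚ s) 0<s Small-error)

  -- The bound `w` on `W` is left open to serve two regimes: the constant s² when Σ₂ is itself
  -- o(m²), and s times the squared distance when Σ₂ is only O(m²).
  chebyshev-Mono-Bi : ∀ (w : ℕ → ℚ) → Eventually (λ n → (p : s ℕ.≤ n) → At.W n p ≤ w n) →
    Chebyshev (λ n → Mono (G n)) (λ n → Σ₂ℚ n * w n + monoError n) × Chebyshev (λ n → Bi (G n)) (λ n → Σ₂ℚ n * w n + monoError n)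
  chebyshev-Mono-Bi w W≤w =
      mapᴱ (λ {n} (p , h) ε 0≤ε → ≤-trans (At.chebyshev n p (Mono (G n)) ε 0≤ε) (var≤ n p (h p))) (fromᴱ s ∩ᴱ W≤w)
    , mapᴱ (λ {n} (p , h) ε 0≤ε → ≤-trans (At.chebyshev n p (Bi (G n)) ε 0≤ε) (≤-trans (≤-reflexive (At.var-Bi n p)) (var≤ n p (h p)))) (fromᴱ s ∩ᴱ W≤w)
    where
    var≤ : ∀ n (p : s ℕ.≤ n) → At.W n p ≤ w n → At.var n p (ℕ→ℚ ∘ Mono (G n)) ≤ Σ₂ℚ n * w n + monoError n
    var≤ n p h = ≤-trans (≤-reflexive (lem (var (ℕ→ℚ ∘ Mono (G n))) (Σ₂ℚ n * W)))
      (+-mono-≤ (*-monoˡ (0≤ℕ (Σ₂ (G n))) h) (≤-trans (p≤∣p∣ (var (ℕ→ℚ ∘ Mono (G n)) - Σ₂ℚ n * W)) var-Mono))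
      where open At n p hiding (Σ₂ℚ)
            lem : ∀ a b → a ≡ b + (a - b)
            lem = solve-∀ ℚ-ring

  concentration-Mono-Bi : ∀ (w : ℕ → ℚ) → Eventually (λ n → (p : s ℕ.≤ n) → At.W n p ≤ w n) → Small (λ n → Σ₂ℚ n * w n) →
    RatioToOneInProb s c (λ n → Bi (G n)) × RatioToOneInProb s c (λ n → Mono (G n))
  concentration-Mono-Bi w W≤w small =
      concentration (λ n → Bi (G n)) β (λ n → Σ₂ℚ n * w n + monoError n) 0<β
        (mapᴱ (λ h → h _ _ (proj₂ (proj₂ distinct-pair))) mean-Bi) (proj₂ (chebyshev-Mono-Bi w W≤w)) (Small-+ small Small-monoError)
    , concentration (λ n → Mono (G n)) β (λ n → Σ₂ℚ n * w n + monoError n) 0<β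
        mean-Mono (proj₁ (chebyshev-Mono-Bi w W≤w)) (Small-+ small Small-monoError)

  module _ (ζ→0 : ∀ ε → 0ℚ < ε → Eventually (λ n → ζSq (G n) ≤ ε)) where
    Small-Σ₂ : Small Σ₂ℚ
    Small-Σ₂ ν 0<ν = mapᴱ (λ {n} (1≤m , h) → ≤-trans (≤-reflexive (sym (ζSq-* n 1≤m))) (*-monoʳ (0≤m² n) h)) (edges→∞ 1 ∩ᴱ ζ→0 ν 0<ν)

    part-i-Mi : ∀ i → RatioToOneInProb s c (λ n → Mi (G n) i)
    part-i-Mi i = concentration (λ n → Mi (G n) i) β (λ n → Σ₂ℚ n + error n) 0<β (mapᴱ (λ h → proj₁ (h i)) mean-Mi)
      (mapᴱ (λ {n} p ε 0≤ε → ≤-trans (At.chebyshev n p (Mi (G n) i) ε 0≤ε) (At.var-Mi n p i)) (fromᴱ s))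
      (Small-+ Small-Σ₂ Small-error)

    part-i-Bi-Mono : RatioToOneInProb s c (λ n → Bi (G n)) × RatioToOneInProb s c (λ n → Mono (G n))
    part-i-Bi-Mono = concentration-Mono-Bi (λ _ → ℕ→ℚ s * (ℕ→ℚ s * 1ℚ)) (0 , λ n _ p → W≤s² n p)
      (Small-mono (0 , λ n _ → ≤-reflexive (*-comm (Σ₂ℚ n) (ℕ→ℚ s * (ℕ→ℚ s * 1ℚ))))
        (Small-* (ℕ→ℚ s * (ℕ→ℚ s * 1ℚ)) (0<* 0<s (0<* 0<s 0<1)) Small-Σ₂))
      where
      W≤s² : ∀ n (p : s ℕ.≤ n) → At.W n p ≤ ℕ→ℚ s * (ℕ→ℚ s * 1ℚ)
      W≤s² n p = ≤-trans (∑-mono (allFin s) (λ i → ∑-mono (allFin s) (λ j → ≤-trans (p≤∣p∣ (At.V n p i j)) (At.∣V∣≤1 n p i j))))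
        (≤-reflexive (trans (∑-cong (allFin s) (λ i → ∑-constFin {s} 1ℚ)) (∑-constFin {s} (ℕ→ℚ s * 1ℚ))))

  module _ (a b : ℚ) (0<a : 0ℚ < a) (0<b : 0ℚ < b)
    (ζ-bounds : Eventually (λ n → (a ≤ ζSq (G n)) × (ζSq (G n) ≤ b))) where

    part-ii-concentration : (∀ ε → 0ℚ < ε → Eventually (λ n → distSq n s (c n) ≤ ε)) →
      RatioToOneInProb s c (λ n → Bi (G n)) × RatioToOneInProb s c (λ n → Mono (G n))
    part-ii-concentration dist→0 = concentration-Mono-Bi (λ n → ℕ→ℚ s * distSq n s (c n)) (0 , λ n _ p → At.W-upper n p 1≤s)
      -- Here Σ₂ is merely at most b m², so the smallness of the product comes from the distance
      -- factor alone.
      (Small-mono (mapᴱ (λ {n} (p , 1≤m , _ , ζ≤b) → ≤-trans (*-monoʳ (0≤* (<⇒≤ 0<s) (At.0≤dist n p))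
            (≤-trans (≤-reflexive (sym (ζSq-* n 1≤m))) (*-monoʳ (0≤m² n) ζ≤b)))
          (≤-reflexive (lem b (m² n) (ℕ→ℚ s) (distSq n s (c n))))) (fromᴱ s ∩ᴱ edges→∞ 1 ∩ᴱ ζ-bounds))
        (Small-* (b * ℕ→ℚ s) (0<* 0<b 0<s) (λ ν 0<ν → mapᴱ (λ {n} h → *-monoʳ (0≤m² n) h) (dist→0 ν 0<ν))))
      where lem : ∀ b t s d → (b * t) * (s * d) ≡ (b * s) * (d * t)
            lem = solve-∀ ℚ-ring

    -- The variance is at least Σ₂ W - o(m²), where Σ₂ ≥ a m² and W ≥ κ² s κ₁ = `w`. Half of a w m²
    -- is spent on the error, and dividing by m² leaves the lower bound ½ a w on the probability.
    part-ii-differs : (∃ λ κ₁ → (0ℚ < κ₁) × Eventually (λ n → κ₁ ≤ distSq n s (c n))) →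
      LiminfDiffersPos s c (λ n → Mono (G n)) × LiminfDiffersPos s c (λ n → Bi (G n))
    part-ii-differs (κ₁ , 0<κ₁ , dist≥κ₁) =
        (½ * aw , 0<* 0<½ 0<aw , mapᴱ (λ {n} (p , 1≤m , h) → cancel n 1≤m (≤-trans (h p) (At.var≤Differs n p (Mono (G n)) (GraphSums.Mono≤m (G n))))) lower)
      , (½ * aw , 0<* 0<½ 0<aw , mapᴱ (λ {n} (p , 1≤m , h) → cancel n 1≤m (≤-trans (≤-trans (h p) (≤-reflexive (sym (At.var-Bi n p))))
          (At.var≤Differs n p (Bi (G n)) (λ f → ℕP.m∸n≤m (numEdges (G n)) (Mono (G n) f))))) lower)
      where
      w aw : ℚ
      w = (κ * κ) * (ℕ→ℚ s * κ₁)
      aw = a * w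
      0<w : 0ℚ < w
      0<w = 0<* 0<κ² (0<* 0<s 0<κ₁)
      0<aw : 0ℚ < aw
      0<aw = 0<* 0<a 0<w
      cancel : ∀ n {p q} → 1 ℕ.≤ numEdges (G n) → p * m² n ≤ m² n * q → p ≤ q
      cancel n {p} {q} 1≤m h = *-cancelʳ-≤-pos (m² n) {{positive (0<* (0<ℕ 1≤m) (0<ℕ 1≤m))}} (≤-trans h (≤-reflexive (*-comm (m² n) q)))
      variance-lower : ∀ n (p : s ℕ.≤ n) → 1 ℕ.≤ numEdges (G n) → (∀ i → κ * ℕ→ℚ n ≤ ℕ→ℚ (c n i)) → a ≤ ζSq (G n) →
        κ₁ ≤ distSq n s (c n) → monoError n ≤ (½ * aw) * m² n → (½ * aw) * m² n ≤ At.var n p (ℕ→ℚ ∘ Mono (G n))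
      variance-lower n p 1≤m hκ a≤ζ κ₁≤d e≤ = begin
        (½ * aw) * m² n                               ≡⟨ trans (cong (_* m² n) (trans (l1 (½ * aw)) (cong (_- ½ * aw) (halves aw)))) (l2 aw (½ * aw) (m² n)) ⟩
        aw * m² n - (½ * aw) * m² n                   ≤⟨ +-mono-≤ main (neg-antimono-≤ e≤) ⟩
        Σ₂ℚ n * W - monoError n                       ≤⟨ +-monoʳ-≤ (Σ₂ℚ n * W) (neg-antimono-≤ (≤-trans (-p≤∣p∣ (var (ℕ→ℚ ∘ Mono (G n)) - Σ₂ℚ n * W)) var-Mono)) ⟩
        Σ₂ℚ n * W - - (var (ℕ→ℚ ∘ Mono (G n)) - Σ₂ℚ n * W) ≡⟨ l3 (Σ₂ℚ n * W) (var (ℕ→ℚ ∘ Mono (G n))) ⟩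
        var (ℕ→ℚ ∘ Mono (G n))                        ∎
        where
        open ≤-Reasoning
        open At n p hiding (Σ₂ℚ)
        l1 : ∀ h → h ≡ (h + h) - h
        l1 = solve-∀ ℚ-ring
        l2 : ∀ a h t → (a - h) * t ≡ a * t - h * t
        l2 = solve-∀ ℚ-ring
        l3 : ∀ u v → u - - (v - u) ≡ v
        l3 = solve-∀ ℚ-ring
        l4 : ∀ a w t → a * w * t ≡ a * t * w
        l4 = solve-∀ ℚ-ring
        main : aw * m² n ≤ Σ₂ℚ n * W
        main = begin
          a * w * m² n                               ≡⟨ l4 a w (m² n) ⟩
          a * m² n * w                               ≤⟨ *-monoʳ (<⇒≤ 0<w) (≤-trans (*-monoʳ (0≤m² n) a≤ζ) (≤-reflexive (ζSq-* n 1≤m))) ⟩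
          Σ₂ℚ n * w                                  ≤⟨ *-monoˡ (0≤ℕ (Σ₂ (G n))) (≤-trans (*-monoˡ (<⇒≤ 0<κ²) (*-monoˡ (<⇒≤ 0<s) κ₁≤d)) (W-lower 1≤s κ (<⇒≤ 0<κ) (κ≤x hκ))) ⟩
          Σ₂ℚ n * W                                  ∎
      lower : Eventually (λ n → (s ℕ.≤ n) × (1 ℕ.≤ numEdges (G n)) × ((p : s ℕ.≤ n) → (½ * aw) * m² n ≤ At.var n p (ℕ→ℚ ∘ Mono (G n))))
      lower = mapᴱ (λ {n} (p , 1≤m , hκ , (a≤ζ , _) , κ₁≤d , e≤) → p , 1≤m , λ p → variance-lower n p 1≤m hκ a≤ζ κ₁≤d e≤)
        (fromᴱ s ∩ᴱ edges→∞ 1 ∩ᴱ large-classes ∩ᴱ ζ-bounds ∩ᴱ dist≥κ₁ ∩ᴱ Small-monoError (½ * aw) (0<* 0<½ 0<aw))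

theorem1 :
  (s : ℕ) → 2 ℕ.≤ s →
  (G : (n : ℕ) → Graph n) →
  (c : ℕ → Fin s → ℕ) →
  -- c_n(s) is a composition of n into s positive parts (whenever n ≥ s)
  (∀ n → s ℕ.≤ n → IsComposition n s (c n)) →
  -- liminf_n  ĉ_n / n > 0
  (∃ λ κ → (0ℚ < κ) × Eventually (λ n → ∀ i → κ * ℕ→ℚ n ≤ ℕ→ℚ (c n i))) →
  -- m_n → ∞
  (∀ K → Eventually (λ n → K ℕ.≤ numEdges (G n))) →
  -- (i) ζ_n = o(1)  (stated via ζ_n² = Σ₂(G_n)/m_n²)
  ((∀ ε → 0ℚ < ε → Eventually (λ n → ζSq (G n) ≤ ε)) →
      (∀ i → RatioToOneInProb s c (λ n → Mi (G n) i))
    × RatioToOneInProb s c (λ n → Bi (G n))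
    × RatioToOneInProb s c (λ n → Mono (G n)))
  ×
  -- (ii) ζ_n = Θ(1)
  ((∃ λ a → ∃ λ b → (0ℚ < a) × (0ℚ < b) ×
      Eventually (λ n → (a ≤ ζSq (G n)) × (ζSq (G n) ≤ b))) →
      -- liminf ‖ n⁻¹ c_n(s) − υ_s ‖ > 0
      ((∃ λ κ → (0ℚ < κ) × Eventually (λ n → κ ≤ distSq n s (c n))) →
          LiminfDiffersPos s c (λ n → Mono (G n))
        × LiminfDiffersPos s c (λ n → Bi (G n)))
    ×
      -- ‖ n⁻¹ c_n(s) − υ_s ‖ → 0
      ((∀ ε → 0ℚ < ε → Eventually (λ n → distSq n s (c n) ≤ ε)) →
          RatioToOneInProb s c (λ n → Bi (G n))
        × RatioToOneInProb s c (λ n → Mono (G n))))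
theorem1 s 2≤s G c isComposition (κ , 0<κ , large-classes) edges→∞ =
    (λ ζ→0 → part-i-Mi ζ→0 , part-i-Bi-Mono ζ→0)
  , λ (a , b , 0<a , 0<b , ζ-bounds) → part-ii-differs a b 0<a 0<b ζ-bounds , part-ii-concentration a b 0<a 0<b ζ-bounds
  where open Asymptotics 2≤s G c isComposition κ 0<κ large-classes edges→∞
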